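{- Let $k\ge1$ be an integer, let $\mathcal{H}_{k+1}$ be the class of $(k+1)$-uniform hypergraphs, and let $\mathcal{H}\subseteq\mathcal{H}_{k+1}$ be a minor-closed subclass. Then there exists a unique map $U:\mathcal{H}\to\mathbb{Z}[x,y,\alpha,a,b]$ such that for every $H\in\mathcal{H}$ and every $e\in E(H)$, $$U(H)=\begin{cases}\alpha^{n},&\text{if }E(H)=\emptyset\text{ and }v(H)=n,\\ a^{k-\Delta(e)}x^{\Delta(e)}\,U(H\setminus e)+b^{k-m(e)}y^{m(e)}\,U(H/e),&\text{otherwise,}\end{cases}$$ where $\Delta(e)=\kappa(H\setminus e)-\kappa(H)$ and $m(e)=k+1-v(e)$. Moreover, for $H=(V,E)\in\mathcal{H}$, $$U(H;x,y,\alpha,a,b)=\alpha^{\kappa(H)}\,a^{k|E|-v(H)+\kappa(H)}\,b^{v(H)-\kappa(H)}\,T_{\mathrm{HG}}\!\left(H;\frac{\alpha x}{b}+1,\frac{y}{a}+1\right).$$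
   Context: A hypergraph is a pair $H=(V,E)$ where $V$ is a finite set and $E=E(H)$ is a finite multiset (parallel hyperedges are allowed and treated as distinct elements of $E$) of multisets of elements of $V$, called hyperedges. For $e\in E$, $d(e)$ is the size of $e$ counted with multiplicity and $v(e)$ is the number of distinct vertices in $e$; it is always assumed that $d(e)>1$. $H$ is $(k+1)$-uniform if $d(e)=k+1$ for all $e\in E$. Write $v(H)=|V|$. $\kappa(H)$ is the number of connected components of the bipartite incidence graph with vertex classes $V$ and $E$, in which $u\in V$ and $e\in E$ are joined by as many edges as the multiplicity of $u$ in $e$. For $A\subseteq E$ let $\kappa(A)=\kappa((V,A))$, $d(A)=\sum_{e\in A}d(e)$, and $|A|$ is the number of hyperedges in $A$. Hypergraph Tutte polynomial: $T_{\mathrm{HG}}(H;x,y)=\sum_{A\subseteq E}(x-1)^{\kappa(A)-\kappa(H)}(y-1)^{d(A)-|A|-v(H)+\kappa(A)}$. Deletion: $H\setminus e=(V,E\setminus\{e\})$. Contraction: $H/e=(V',E')$ with $V'=(V\setminus e)\cup\{v_e\}$ (all vertices occurring in $e$ are removed and one new vertex $v_e$ is added) and $E'=\{f':f\in E\setminus\{e\}\}$, where $f'$ is obtained from $f$ by replacing every occurrence (with multiplicity) of a vertex of $e$ by $v_e$; thus $d(f')=d(f)$ and uniformity is preserved. Minor-closed means closed under these deletions and contractions. The condition $U(H)=\alpha^n$ is imposed for every edgeless $H\in\mathcal{H}$ on $n$ vertices, and the recursion for every $H$ with $E(H)\ne\emptyset$ and every $e\in E(H)$. -}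

module Defs where

open import Level using (0ℓ)
open import Algebra.Bundles.Raw using (RawRing)
import Algebra.Definitions.RawSemiring as RawSemiringDefs
open import Data.Nat.Base using (ℕ; zero; suc; _+_; _∸_)
import Data.Nat.Base as ℕ
import Data.Nat.Properties as ℕ
open import Data.Integer.Base using (ℤ; 0ℤ; 1ℤ; -1ℤ)
import Data.Integer.Base as ℤ
import Data.Integer.Properties as ℤ
open import Data.Fin.Base using (Fin)
import Data.Fin.Properties as Fin
open import Data.List.Base
  using (List; []; _∷_; _++_; map; foldr; length; lookup; removeAt; allFin;
         deduplicate; cartesianProductWith)
open import Data.Nat.ListAction using (sum)
open import Data.List.Membership.Propositional using () renaming (_∈_ to _∈ˡ_)
open import Data.List.Membership.Propositional.Properties
  using (∈-++⁺ˡ; ∈-++⁺ʳ; ∈-map⁺; ∈-allFin)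
open import Data.List.Relation.Unary.Any using (here; there)
open import Data.Vec.Base using (Vec; []; _∷_; zipWith; replicate)
import Data.Vec.Base as Vec
import Data.Vec.Properties as Vec
open import Data.Product.Base using (_×_; _,_; map₁; map₂)
open import Data.Sum.Base using (_⊎_; inj₁; inj₂)
import Data.Sum.Properties as Sum
open import Data.Empty using (⊥)
open import Relation.Binary.Core using (Rel)
open import Relation.Binary.Definitions using (Decidable; DecidableEquality)
open import Relation.Binary.PropositionalEquality.Core using (_≡_; _≢_; refl)
open import Relation.Binary.Construct.Closure.ReflexiveTransitive
  using (Star; ε; _◅_; _◅◅_)
open import Relation.Binary.Construct.Closure.Symmetric using (SymClosure; fwd; bwd)
open import Relation.Binary.Construct.Closure.Equivalence using (EqClosure)
open import Relation.Nullary.Decidable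
  using (no; map′; ¬?; _⊎-dec_; _×-dec_; does)
open import Relation.Unary using (Pred; _∈_)
open import Data.Bool.Base using (if_then_else_)

-- The vertex set is Fin n.  A multiset of vertices is its vector of
-- multiplicities.
Hyperedge : ℕ → Set
Hyperedge = Vec ℕ

-- A list position is a hyperedge, so parallel hyperedges are distinct.
-- Sizes d(e) > 1 are not built in: they follow from (k+1)-uniformity
-- when k ≥ 1.
record Hypergraph : Set where
  constructor hypergraph
  field
    v     : ℕ
    edges : List (Hyperedge v)

open Hypergraph public

E : Hypergraph → Set
E H = Fin (length (edges H))

edge : (H : Hypergraph) → E H → Hyperedge (v H)
edge H = lookup (edges H)

∣E∣ : Hypergraph → ℕ
∣E∣ H = length (edges H)

dₑ : ∀ {n} → Hyperedge n → ℕ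
dₑ = Vec.sum

vₑ : ∀ {n} → Hyperedge n → ℕ
vₑ []          = 0
vₑ (zero  ∷ e) = vₑ e
vₑ (suc _ ∷ e) = suc (vₑ e)

Uniform : ℕ → Pred Hypergraph 0ℓ
Uniform r H = ∀ (e : E H) → dₑ (edge H e) ≡ r

infixl 6 _∖_ _/_

_∖_ : (H : Hypergraph) → E H → Hypergraph
H ∖ e = hypergraph (v H) (removeAt (edges H) e)

-- The number of vertices not in e.
outside : ∀ {n} → Hyperedge n → ℕ
outside []          = 0
outside (zero  ∷ e) = suc (outside e)
outside (suc _ ∷ e) = outside e

-- The multiplicities in f of the vertices not in e, in order.
restrict : ∀ {n} (e : Hyperedge n) → Hyperedge n → Hyperedge (outside e)
restrict []          []      = []
restrict (zero  ∷ e) (c ∷ f) = c ∷ restrict e f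
restrict (suc _ ∷ e) (c ∷ f) = restrict e f

-- The number of occurrences in f of vertices of e.
hits : ∀ {n} → Hyperedge n → Hyperedge n → ℕ
hits []          []      = 0
hits (zero  ∷ e) (c ∷ f) = hits e f
hits (suc _ ∷ e) (c ∷ f) = c + hits e f

-- In the contraction the new vertex is vertex 0, followed by the
-- vertices outside e in their original order.
contractEdge : ∀ {n} (e : Hyperedge n) → Hyperedge n → Hyperedge (suc (outside e))
contractEdge e f = hits e f ∷ restrict e f

_/_ : (H : Hypergraph) → E H → Hypergraph
H / e = hypergraph (suc (outside (edge H e)))
                   (map (contractEdge (edge H e)) (removeAt (edges H) e))

record MinorClosed {ℓ} (𝓗 : Pred Hypergraph ℓ) : Set ℓ where
  field
    deletion    : ∀ {H} → H ∈ 𝓗 → (e : E H) → H ∖ e ∈ 𝓗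
    contraction : ∀ {H} → H ∈ 𝓗 → (e : E H) → H / e ∈ 𝓗

-- Reachability in a finite relation is decidable (Warshall's algorithm).
module _ {A : Set} {R : Rel A 0ℓ} (_≟_ : DecidableEquality A) (R? : Decidable R) where

  private
    -- There is a walk from x to y with all its inner vertices in ks.
    Via : List A → Rel A 0ℓ
    Via []       x y = x ≡ y ⊎ R x y
    Via (k ∷ ks) x y = Via ks x y ⊎ (Via ks x k × Via ks k y)

    via? : ∀ ks → Decidable (Via ks)
    via? []       x y = (x ≟ y) ⊎-dec R? x y
    via? (k ∷ ks) x y = via? ks x y ⊎-dec (via? ks x k ×-dec via? ks k y)

    sound : ∀ ks {x y} → Via ks x y → Star R x y
    sound []       (inj₁ refl)    = ε
    sound []       (inj₂ r)       = r ◅ ε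
    sound (k ∷ ks) (inj₁ p)       = sound ks p
    sound (k ∷ ks) (inj₂ (p , q)) = sound ks p ◅◅ sound ks q

    base : ∀ ks {x y} → Via [] x y → Via ks x y
    base []       p = p
    base (k ∷ ks) p = inj₁ (base ks p)

    join : ∀ {ks z} → z ∈ˡ ks → ∀ {x y} → Via ks x z → Via ks z y → Via ks x y
    join (here refl) (inj₁ p)       (inj₁ q)        = inj₂ (p , q)
    join (here refl) (inj₁ p)       (inj₂ (_ , q))  = inj₂ (p , q)
    join (here refl) (inj₂ (p , _)) (inj₁ q)        = inj₂ (p , q)
    join (here refl) (inj₂ (p , _)) (inj₂ (_ , q))  = inj₂ (p , q)
    join (there z∈)  (inj₁ p)       (inj₁ q)        = inj₁ (join z∈ p q)
    join (there z∈)  (inj₁ p)       (inj₂ (q , q′)) = inj₂ (join z∈ p q , q′)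
    join (there z∈)  (inj₂ (p , p′)) (inj₁ q)       = inj₂ (p , join z∈ p′ q)
    join (there z∈)  (inj₂ (p , _)) (inj₂ (_ , q))  = inj₂ (p , q)

  star? : (ks : List A) → (∀ x → x ∈ˡ ks) → Decidable (Star R)
  star? ks full x y = map′ (sound ks) complete (via? ks x y)
    where
    complete : ∀ {x y} → Star R x y → Via ks x y
    complete ε        = base ks (inj₁ refl)
    complete (r ◅ rs) = join (full _) (base ks (inj₂ r)) (complete rs)

Node : Hypergraph → Set
Node H = Fin (v H) ⊎ E H

Incident : (H : Hypergraph) → Rel (Node H) 0ℓ
Incident H (inj₁ u) (inj₂ e) = Vec.lookup (edge H e) u ≢ 0
Incident H _        _        = ⊥

Connected : (H : Hypergraph) → Rel (Node H) 0ℓ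
Connected H = EqClosure (Incident H)

nodes : (H : Hypergraph) → List (Node H)
nodes H = map inj₁ (allFin (v H)) ++ map inj₂ (allFin (∣E∣ H))

∈-nodes : (H : Hypergraph) (x : Node H) → x ∈ˡ nodes H
∈-nodes H (inj₁ u) = ∈-++⁺ˡ (∈-map⁺ inj₁ (∈-allFin u))
∈-nodes H (inj₂ e) = ∈-++⁺ʳ (map inj₁ (allFin (v H))) (∈-map⁺ inj₂ (∈-allFin e))

incident? : (H : Hypergraph) → Decidable (Incident H)
incident? H (inj₁ _) (inj₁ _) = no λ ()
incident? H (inj₁ u) (inj₂ e) = ¬? (Vec.lookup (edge H e) u ℕ.≟ 0)
incident? H (inj₂ _) _        = no λ ()

connected? : (H : Hypergraph) → Decidable (Connected H)
connected? H = star? (Sum.≡-dec Fin._≟_ Fin._≟_) adjacent? (nodes H) (∈-nodes H)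
  where
  adjacent? : Decidable (SymClosure (Incident H))
  adjacent? x y = map′ (λ { (inj₁ p) → fwd p ; (inj₂ p) → bwd p })
                       (λ { (fwd p) → inj₁ p ; (bwd p) → inj₂ p })
                       (incident? H x y ⊎-dec incident? H y x)

-- Deduplicating the nodes up to connectedness leaves exactly one node
-- in each component.
κ : Hypergraph → ℕ
κ H = length (deduplicate (connected? H) (nodes H))

-- All 2 ^ length xs ways of choosing a set of positions of xs.
sublists : ∀ {a} {A : Set a} → List A → List (List A)
sublists []       = [] ∷ []
sublists (x ∷ xs) = sublists xs ++ map (x ∷_) (sublists xs)

-- Both truncated subtractions have a nonnegative true value: κ only
-- grows when hyperedges are removed, and the second exponent is the
-- cyclomatic number of the incidence graph of (V, A).
T-HG : ∀ {c ℓ} (R : RawRing c ℓ) → Hypergraph →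
       RawRing.Carrier R → RawRing.Carrier R → RawRing.Carrier R
T-HG R H x y = foldr R._+_ R.0# (map term (sublists (edges H)))
  where
  module R = RawRing R
  open RawSemiringDefs R.rawSemiring using (_^_)
  term : List (Hyperedge (v H)) → R.Carrier
  term A =
    (x R.+ R.- R.1#) ^ (κA ∸ κ H) R.*
    (y R.+ R.- R.1#) ^ ((sum (map dₑ A) + κA) ∸ (length A + v H))
    where
    κA : ℕ
    κA = κ (hypergraph (v H) A)

-- N is the monoid of exponents of a single variable: ℕ for polynomials,
-- ℤ for Laurent polynomials.
module MonomialRing {N : Set} (_⊕_ : N → N → N) (𝟘 : N)
                    (_≟_ : DecidableEquality N) (r : ℕ) where

  Exponent : Set
  Exponent = Vec N r

  -- A formal sum of terms (coefficient, exponents), in which a monomial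
  -- may be repeated and coefficients may vanish; hence the equality _≈_.
  Carrier : Set
  Carrier = List (ℤ × Exponent)

  coeff : Carrier → Exponent → ℤ
  coeff []            m = 0ℤ
  coeff ((c , m′) ∷ p) m =
    (if does (Vec.≡-dec _≟_ m′ m) then c else 0ℤ) ℤ.+ coeff p m

  _⊗_ : ℤ × Exponent → ℤ × Exponent → ℤ × Exponent
  (c , m) ⊗ (c′ , m′) = c ℤ.* c′ , zipWith _⊕_ m m′

  rawRing : RawRing 0ℓ 0ℓ
  rawRing = record
    { Carrier = Carrier
    ; _≈_     = λ p q → ∀ m → coeff p m ≡ coeff q m
    ; _+_     = _++_
    ; _*_     = cartesianProductWith _⊗_
    ; -_      = map (map₁ (λ c → ℤ.- c))
    ; 0#      = []
    ; 1#      = (1ℤ , replicate r 𝟘) ∷ []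
    }

  monomial : Exponent → Carrier
  monomial m = (1ℤ , m) ∷ []

-- ℤ[x,y,α,a,b], with exponents listed in this order of the variables.
module Poly where
  open MonomialRing _+_ 0 ℕ._≟_ 5 public using (rawRing; monomial)
  open RawRing rawRing public
  open RawSemiringDefs rawSemiring public using (_^_)

  x y α a b : Carrier
  x = monomial (1 ∷ 0 ∷ 0 ∷ 0 ∷ 0 ∷ [])
  y = monomial (0 ∷ 1 ∷ 0 ∷ 0 ∷ 0 ∷ [])
  α = monomial (0 ∷ 0 ∷ 1 ∷ 0 ∷ 0 ∷ [])
  a = monomial (0 ∷ 0 ∷ 0 ∷ 1 ∷ 0 ∷ [])
  b = monomial (0 ∷ 0 ∷ 0 ∷ 0 ∷ 1 ∷ [])

-- The subring ℤ[x,y,α,a,b][x⁻¹,y⁻¹,α⁻¹,a⁻¹,b⁻¹] of the field of rational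
-- functions; it contains αx/b and y/a.
module Laurent where
  open MonomialRing ℤ._+_ 0ℤ ℤ._≟_ 5 public using (rawRing; monomial)
  open RawRing rawRing public
  open RawSemiringDefs rawSemiring public using (_^_)

  ι : Poly.Carrier → Carrier
  ι = map (map₂ (Vec.map (λ n → ℤ.+ n)))

  x y α a b a⁻¹ b⁻¹ : Carrier
  x = ι Poly.x
  y = ι Poly.y
  α = ι Poly.α
  a = ι Poly.a
  b = ι Poly.b
  a⁻¹ = monomial (0ℤ ∷ 0ℤ ∷ 0ℤ ∷ -1ℤ ∷ 0ℤ ∷ [])
  b⁻¹ = monomial (0ℤ ∷ 0ℤ ∷ 0ℤ ∷ 0ℤ ∷ -1ℤ ∷ [])

Invariant : ∀ {ℓ} → Pred Hypergraph ℓ → Set ℓ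
Invariant 𝓗 = (H : Hypergraph) → H ∈ 𝓗 → Poly.Carrier

infix 4 _≗_

_≗_ : ∀ {ℓ} {𝓗 : Pred Hypergraph ℓ} → Rel (Invariant 𝓗) ℓ
U ≗ U′ = ∀ H H∈𝓗 → U H H∈𝓗 Poly.≈ U′ H H∈𝓗

Δ : (H : Hypergraph) → E H → ℕ
Δ H e = κ (H ∖ e) ∸ κ H

-- On (k+1)-uniform hypergraphs, Δ(e) ≤ v(e) - 1 ≤ k and m(e) ≤ k, so no
-- subtraction here or in Δ is truncated.
record Recursion {ℓ} (k : ℕ) {𝓗 : Pred Hypergraph ℓ} (closed : MinorClosed 𝓗)
                 (U : Invariant 𝓗) : Set ℓ where
  open MinorClosed closed
  open Poly using (_≈_; _*_; _^_; x; y; α; a; b)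

  m : (H : Hypergraph) → E H → ℕ
  m H e = suc k ∸ vₑ (edge H e)

  field
    edgeless : ∀ H (H∈𝓗 : H ∈ 𝓗) → edges H ≡ [] → U H H∈𝓗 ≈ α ^ v H
    step     : ∀ H (H∈𝓗 : H ∈ 𝓗) (e : E H) →
      U H H∈𝓗 ≈ (a ^ (k ∸ Δ H e) * x ^ Δ H e * U (H ∖ e) (deletion H∈𝓗 e))
        Poly.+  (b ^ (k ∸ m H e) * y ^ m H e * U (H / e) (contraction H∈𝓗 e))

-- Truncation is again harmless: κ(H) ≤ v(H), and for (k+1)-uniform H the
-- first difference is the cyclomatic number of the incidence graph.
closedForm : ℕ → Hypergraph → Laurent.Carrier
closedForm k H =
  α ^ κ H * a ^ ((k ℕ.* ∣E∣ H + κ H) ∸ v H) * b ^ (v H ∸ κ H) *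
  T-HG Laurent.rawRing H (α * x * b⁻¹ ⊹ 1#) (y * a⁻¹ ⊹ 1#)
  where
  open Laurent using (_*_; _^_; 1#; x; y; α; a; b; a⁻¹; b⁻¹) renaming (_+_ to _⊹_)

{-# OPTIONS --safe #-}

-- Expanding T-HG in the closed formula gives the polynomial
--   U(H) = Σ_A x^(κ(A)-κ(H)) y^(k|A|-v(H)+κ(A)) α^κ(A) a^(k(|E|-|A|)-κ(A)+κ(H)) b^(v(H)-κ(A)),
-- the sum being over A ⊆ E.  The terms with e ∉ A are the terms of U(H∖e) times
-- a^(k-Δ(e)) x^Δ(e), and the terms with e ∈ A are those of U(H/e), at A∖e, times
-- b^(k-m(e)) y^m(e), because contracting e changes neither κ(H) nor κ(A).  All
-- exponents are nonnegative since deleting a hyperedge creates at most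
-- v(e)-1 ≤ k components.  Uniqueness is induction on |E|.
module Submission where

open import Defs
open import Level using (0ℓ)
open import Algebra.Bundles.Raw using (RawRing)
import Algebra.Definitions.RawSemiring as RawSemiringDefs
import Algebra.Properties.CommutativeSemigroup as CommutativeSemigroupProperties
open import Data.Bool.Base using (if_then_else_; true; false)
open import Data.Nat.Base using (ℕ; zero; suc; _≤_)
import Data.Nat.Base as ℕ
import Data.Nat.Properties as ℕ
open import Data.Nat.ListAction using (sum)
open import Data.Nat.Tactic.RingSolver using (solve-∀)
open import Data.Integer.Base using (ℤ; 0ℤ; 1ℤ; -1ℤ)
import Data.Integer.Base as ℤ
import Data.Integer.Properties as ℤ
open import Data.Fin.Base using (Fin; zero; suc)
open import Data.Fin.Properties using (suc-injective)
open import Data.Vec.Base as Vec using (Vec; []; _∷_; zipWith; replicate)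
import Data.Vec.Properties as Vec
open import Data.List.Base
  using (List; []; _∷_; _++_; map; foldr; length; lookup; removeAt; allFin;
         deduplicate; filter)
import Data.List.Properties as List
open import Data.List.Membership.Propositional using (lose) renaming (_∈_ to _∈ˡ_)
open import Data.List.Membership.Propositional.Properties
  using (∈-lookup; ∈-map⁺; ∈-map⁻; ∈-++⁺ˡ; ∈-++⁺ʳ; ∈-filter⁺; ∈-deduplicate⁺)
open import Data.List.Relation.Unary.All as All using (All; []; _∷_)
import Data.List.Relation.Unary.All.Properties as All
open import Data.List.Relation.Unary.Any as Any using (Any; here; there; _─_)
import Data.List.Relation.Unary.Any.Properties as Any
open import Data.List.Relation.Unary.AllPairs as AllPairs using (AllPairs; []; _∷_)
import Data.List.Relation.Unary.AllPairs.Properties as AllPairs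
open import Data.List.Relation.Unary.Unique.Propositional using (Unique)
open import Data.List.Relation.Unary.Unique.Propositional.Properties using (allFin⁺)
import Data.List.Relation.Unary.Unique.DecSetoid.Properties as DecSetoidUnique
open import Data.List.Relation.Unary.Unique.DecPropositional.Properties using (deduplicate-!)
open import Data.List.Relation.Binary.Sublist.Propositional as Sublist
  using ([]; _∷_; _∷ʳ_; minimum; ⊆-refl) renaming (_⊆_ to _⊑_)
open import Data.List.Relation.Binary.Sublist.Propositional.Properties using (All-resp-⊆)
open import Data.List.Relation.Binary.Subset.Propositional using () renaming (_⊆_ to _⊆ˡ_)
open import Data.List.Relation.Binary.Subset.Propositional.Properties
  using (All-resp-⊇; xs⊆x∷xs)
open import Data.List.Relation.Binary.Permutation.Propositional as ↭
  using (_↭_; ↭-sym; ↭-trans; ↭-refl; ↭-reflexive)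
import Data.List.Relation.Binary.Permutation.Propositional.Properties as ↭
open import Data.Product using (∃; ∃!; _×_; _,_; proj₁; proj₂; map₂)
open import Data.Sum.Base using (_⊎_; inj₁; inj₂; [_,_]′)
open import Function.Base using (_∘_; id)
open import Relation.Binary.Bundles using (Setoid; DecSetoid)
open import Relation.Binary.Core using (Rel)
open import Relation.Binary.Definitions using (DecidableEquality)
open import Relation.Binary.PropositionalEquality hiding (_≗_)
open import Relation.Binary.Construct.Closure.ReflexiveTransitive using (ε; _◅_; _◅◅_)
open import Relation.Binary.Construct.Closure.Symmetric using (fwd; bwd)
import Relation.Binary.Construct.Closure.Equivalence as EqClosure
open import Relation.Nullary using (¬_; ¬?; yes; no; does; contradiction)
open import Relation.Unary using (Pred; _∈_; _⊆_)

-- Formal sums of monomials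

open CommutativeSemigroupProperties ℤ.+-commutativeSemigroup using (interchange; x∙yz≈y∙xz)

-- Defining `U` by the recursion would require a proof that its value does not depend on the
-- hyperedge chosen at each step; the explicit sum avoids this. Each `A` contributes one monomial
-- with coefficient 1, and both weights in the recursion are monomials, so the recursion is an
-- equality of term lists up to reordering. Congruence of products for `≈` is needed only for
-- uniqueness and for the substitution into `T-HG`. Two obstacles shape the rest. Subtraction of
-- exponents is truncated, so the identities between them need inequalities, chiefly the chain κ(H)
-- ≤ κ(A) ≤ v(H) ≤ k|A| + κ(A) ≤ k|E| + κ(H). And κ is the length of a computed list of
-- representatives, so components are compared by counting: representatives are pairwise
-- unconnected, every node is connected to one of them, and a pigeonhole argument turns this into
-- inequalities.

+-congˡ : ∀ i {j k} → j ≡ k → i ℤ.+ j ≡ i ℤ.+ k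
+-congˡ i refl = refl

module FormalSum {N : Set} (_⊕_ : N → N → N) (𝟘 : N) (_≟_ : DecidableEquality N) (r : ℕ) where

  open MonomialRing _⊕_ 𝟘 _≟_ r public
  open RawRing rawRing public using (_≈_; _+_; _*_; -_; 0#; 1#)
  open RawSemiringDefs (RawRing.rawSemiring rawRing) public using (_^_)

  _≟ᵉ_ : DecidableEquality Exponent
  _≟ᵉ_ = Vec.≡-dec _≟_

  ≈-setoid : Setoid 0ℓ 0ℓ
  ≈-setoid = record
    { Carrier = Carrier ; _≈_ = _≈_
    ; isEquivalence = record
        { refl  = λ m → refl
        ; sym   = λ p≈q m → sym (p≈q m)
        ; trans = λ p≈q q≈r m → trans (p≈q m) (q≈r m) } }

  open Setoid ≈-setoid public using ()
    renaming (refl to ≈-refl; sym to ≈-sym; trans to ≈-trans; reflexive to ≈-reflexive)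

  point : ℤ → Exponent → Exponent → ℤ
  point c m m′ = if does (m ≟ᵉ m′) then c else 0ℤ

  -- The ℤ-linear functional that takes the value `g m` at the monomial with exponents `m`.
  eval : (Exponent → ℤ) → Carrier → ℤ
  eval g []            = 0ℤ
  eval g ((c , m) ∷ p) = c ℤ.* g m ℤ.+ eval g p

  eval-ext : ∀ {g h} → (∀ m → g m ≡ h m) → ∀ p → eval g p ≡ eval h p
  eval-ext g≗h []            = refl
  eval-ext g≗h ((c , m) ∷ p) = cong₂ (λ s t → c ℤ.* s ℤ.+ t) (g≗h m) (eval-ext g≗h p)

  private

    weigh : (Exponent → ℤ) → (Exponent → ℤ) → List Exponent → ℤ
    weigh f g = foldr (λ m s → f m ℤ.* g m ℤ.+ s) 0ℤ

    weigh-+ : ∀ f f′ g ks → weigh (λ m → f m ℤ.+ f′ m) g ks ≡ weigh f g ks ℤ.+ weigh f′ g ks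
    weigh-+ f f′ g []       = refl
    weigh-+ f f′ g (m ∷ ks) = trans
      (cong₂ ℤ._+_ (ℤ.*-distribʳ-+ (g m) (f m) (f′ m)) (weigh-+ f f′ g ks))
      (interchange (f m ℤ.* g m) (f′ m ℤ.* g m) (weigh f g ks) (weigh f′ g ks))

    weigh-ext : ∀ {f f′} → (∀ m → f m ≡ f′ m) → ∀ g ks → weigh f g ks ≡ weigh f′ g ks
    weigh-ext f≗f′ g []       = refl
    weigh-ext f≗f′ g (m ∷ ks) = cong₂ (λ s t → s ℤ.* g m ℤ.+ t) (f≗f′ m) (weigh-ext f≗f′ g ks)

    weigh-0 : ∀ g ks → weigh (λ _ → 0ℤ) g ks ≡ 0ℤ
    weigh-0 g []       = refl
    weigh-0 g (m ∷ ks) = trans (ℤ.+-identityˡ _) (weigh-0 g ks)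

    weigh-point-∉ : ∀ c m g {ks} → All (m ≢_) ks → weigh (point c m) g ks ≡ 0ℤ
    weigh-point-∉ c m g [] = refl
    weigh-point-∉ c m g (_∷_ {x = m′} m≢m′ m∉ks) with m ≟ᵉ m′
    ... | yes m≡m′ = contradiction m≡m′ m≢m′
    ... | no  _    = trans (ℤ.+-identityˡ _) (weigh-point-∉ c m g m∉ks)

    weigh-point-∈ : ∀ c m g {ks} → Unique ks → m ∈ˡ ks → weigh (point c m) g ks ≡ c ℤ.* g m
    weigh-point-∈ c m g (m∉ks ∷ _) (here refl) with m ≟ᵉ m
    ... | yes _   = trans (+-congˡ (c ℤ.* g m) (weigh-point-∉ c m g m∉ks)) (ℤ.+-identityʳ _)
    ... | no  m≢m = contradiction refl m≢m
    weigh-point-∈ c m g (m′∉ks ∷ ks!) (there {x = m′} m∈ks) with m ≟ᵉ m′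
    ... | yes refl = contradiction refl (All.lookup m′∉ks m∈ks)
    ... | no  _    = trans (ℤ.+-identityˡ _) (weigh-point-∈ c m g ks! m∈ks)

    -- Both sides are additive in `p`, and a single term contributes on the right only where its own
    -- monomial stands in `ks`, which `Unique` makes exactly one place.
    eval≡weigh : ∀ g {ks} → Unique ks → ∀ p → (∀ {m} → m ∈ˡ map proj₂ p → m ∈ˡ ks) →
                 eval g p ≡ weigh (coeff p) g ks
    eval≡weigh g {ks} ks! []            p⊆ks = sym (weigh-0 g ks)
    eval≡weigh g {ks} ks! ((c , m) ∷ p) p⊆ks = begin
      c ℤ.* g m ℤ.+ eval g p
        ≡⟨ cong₂ ℤ._+_ (weigh-point-∈ c m g ks! (p⊆ks (here refl)))
                       (sym (eval≡weigh g ks! p (p⊆ks ∘ there))) ⟨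
      weigh (point c m) g ks ℤ.+ weigh (coeff p) g ks
        ≡⟨ weigh-+ (point c m) (coeff p) g ks ⟨
      weigh (coeff ((c , m) ∷ p)) g ks ∎
      where open ≡-Reasoning

  -- Summing over a duplicate-free list of all the monomials that occur turns
  -- eval g p into a function of the coefficients alone.  Every operation below
  -- respects _≈_ because its coefficients are values of eval.
  eval-cong : ∀ g {p q} → p ≈ q → eval g p ≡ eval g q
  eval-cong g {p} {q} p≈q = begin
    eval g p               ≡⟨ eval≡weigh g ks! p (∈-deduplicate⁺ _≟ᵉ_ ∘ ∈-++⁺ˡ) ⟩
    weigh (coeff p) g ks   ≡⟨ weigh-ext p≈q g ks ⟩
    weigh (coeff q) g ks   ≡⟨ eval≡weigh g ks! q (∈-deduplicate⁺ _≟ᵉ_ ∘ ∈-++⁺ʳ (map proj₂ p)) ⟨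
    eval g q               ∎
    where
    open ≡-Reasoning
    ks  = deduplicate _≟ᵉ_ (map proj₂ p ++ map proj₂ q)
    ks! = deduplicate-! _≟ᵉ_ (map proj₂ p ++ map proj₂ q)

  coeff-++ : ∀ p q m → coeff (p ++ q) m ≡ coeff p m ℤ.+ coeff q m
  coeff-++ []            q m = sym (ℤ.+-identityˡ _)
  coeff-++ ((c , m′) ∷ p) q m =
    trans (+-congˡ (point c m′ m) (coeff-++ p q m)) (sym (ℤ.+-assoc (point c m′ m) (coeff p m) (coeff q m)))

  +-cong : ∀ {p p′ q q′} → p ≈ p′ → q ≈ q′ → p + q ≈ p′ + q′
  +-cong {p} {p′} {q} {q′} p≈ q≈ m =
    trans (coeff-++ p q m) (trans (cong₂ ℤ._+_ (p≈ m) (q≈ m)) (sym (coeff-++ p′ q′ m)))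

  ↭⇒≈ : ∀ {p q} → p ↭ q → p ≈ q
  ↭⇒≈ ↭.refl                m = refl
  ↭⇒≈ (↭.prep (c , m′) p↭q) m = +-congˡ (point c m′ m) (↭⇒≈ p↭q m)
  ↭⇒≈ {_ ∷ _ ∷ p} (↭.swap (c , m′) (d , m″) p↭q) m =
    trans (x∙yz≈y∙xz (point c m′ m) (point d m″ m) (coeff p m))
          (+-congˡ (point d m″ m) (+-congˡ (point c m′ m) (↭⇒≈ p↭q m)))
  ↭⇒≈ (↭.trans p↭q q↭r)     m = trans (↭⇒≈ p↭q m) (↭⇒≈ q↭r m)

  shift : Exponent → Carrier → Carrier
  shift m = map (map₂ (zipWith _⊕_ m))

  -- An equality of lists, not merely `≈`: it lets the recursion be checked term by term.
  monomial-* : ∀ m p → monomial m * p ≡ shift m p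
  monomial-* m p = trans (List.++-identityʳ _)
    (List.map-cong (λ (c , m′) → cong (_, zipWith _⊕_ m m′) (ℤ.*-identityˡ c)) p)

  monomial-*-monomial : ∀ m m′ → monomial m * monomial m′ ≡ monomial (zipWith _⊕_ m m′)
  monomial-*-monomial m m′ = monomial-* m (monomial m′)

  -- The exponents of the powers are supplied as a function `f`, because for the variables both
  -- conditions on an explicit `f` hold by computation.
  monomial-^ : ∀ {m} (f : ℕ → Exponent) → f 0 ≡ replicate r 𝟘 →
               (∀ n → f (suc n) ≡ zipWith _⊕_ m (f n)) → ∀ n → monomial m ^ n ≡ monomial (f n)
  monomial-^     f f0 f1 zero    = cong monomial (sym f0)
  monomial-^ {m} f f0 f1 (suc n) = begin
    monomial m * monomial m ^ n        ≡⟨ cong (monomial m *_) (monomial-^ f f0 f1 n) ⟩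
    monomial m * monomial (f n)        ≡⟨ monomial-*-monomial m (f n) ⟩
    monomial (zipWith _⊕_ m (f n))     ≡⟨ cong monomial (f1 n) ⟨
    monomial (f (suc n))               ∎
    where open ≡-Reasoning

  -- The formal sum keeps all three terms; 1 and -1 cancel only in the coefficient of the constant
  -- monomial.
  monomial+1-1 : ∀ m → monomial m + 1# + (- 1#) ≈ monomial m
  monomial+1-1 m m′ with does (replicate r 𝟘 ≟ᵉ m′)
  ... | true  = refl
  ... | false = refl

module _ {N₁ : Set} {_⊕₁_ : N₁ → N₁ → N₁} {𝟘₁ : N₁} {_≟₁_ : DecidableEquality N₁} {r₁ : ℕ}
         {N₂ : Set} {_⊕₂_ : N₂ → N₂ → N₂} {𝟘₂ : N₂} {_≟₂_ : DecidableEquality N₂} {r₂ : ℕ} where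

  private
    module S₁ = FormalSum _⊕₁_ 𝟘₁ _≟₁_ r₁
    module S₂ = FormalSum _⊕₂_ 𝟘₂ _≟₂_ r₂

  -- `φ` may identify exponents, so a coefficient of the image collects several coefficients of `p`.
  -- Used for `shift` and for `ι`, whose exponents lie in different monoids.
  coeff-map₂ : ∀ (φ : S₁.Exponent → S₂.Exponent) p m →
               S₂.coeff (map (map₂ φ) p) m ≡ S₁.eval (λ m′ → S₂.coeff (S₂.monomial (φ m′)) m) p
  coeff-map₂ φ []             m = refl
  coeff-map₂ φ ((c , m′) ∷ p) m with does (φ m′ S₂.≟ᵉ m)
  ... | true  = cong₂ ℤ._+_ (sym (ℤ.*-identityʳ c)) (coeff-map₂ φ p m)
  ... | false = cong₂ ℤ._+_ (sym (ℤ.*-zeroʳ c)) (coeff-map₂ φ p m)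

  map₂-cong : ∀ (φ : S₁.Exponent → S₂.Exponent) {p q} → p S₁.≈ q → map (map₂ φ) p S₂.≈ map (map₂ φ) q
  map₂-cong φ {p} {q} p≈q m =
    trans (coeff-map₂ φ p m) (trans (S₁.eval-cong _ {p} {q} p≈q) (sym (coeff-map₂ φ q m)))

-- Congruence of multiplication

module Multiplication {N : Set} (_⊕_ : N → N → N) (𝟘 : N) (_≟_ : DecidableEquality N) (r : ℕ) where

  open FormalSum _⊕_ 𝟘 _≟_ r

  shift-cong : ∀ m {p q} → p ≈ q → shift m p ≈ shift m q
  shift-cong m {p} {q} = map₂-cong {_⊕₁_ = _⊕_} {𝟘} {_≟_} {r} {_⊕₂_ = _⊕_} {𝟘} {_≟_} {r} (zipWith _⊕_ m) {p} {q}

  coeff-⊗ : ∀ c m q m′ → coeff (map ((c , m) ⊗_) q) m′ ≡ c ℤ.* coeff (shift m q) m′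
  coeff-⊗ c m []             m′ = sym (ℤ.*-zeroʳ c)
  coeff-⊗ c m ((d , m″) ∷ q) m′ with does (zipWith _⊕_ m m″ ≟ᵉ m′)
  ... | true  = trans (+-congˡ (c ℤ.* d) (coeff-⊗ c m q m′)) (sym (ℤ.*-distribˡ-+ c d _))
  ... | false = trans (ℤ.+-identityˡ _) (trans (coeff-⊗ c m q m′) (cong (c ℤ.*_) (sym (ℤ.+-identityˡ _))))

  -- For fixed `q` the product is linear in `p`, hence a value of `eval`; this gives congruence in
  -- the left factor, and `shift-cong` gives it in the right one.
  coeff-* : ∀ p q m → coeff (p * q) m ≡ eval (λ m′ → coeff (shift m′ q) m) p
  coeff-* []             q m = refl
  coeff-* ((c , m′) ∷ p) q m = trans (coeff-++ (map ((c , m′) ⊗_) q) (p * q) m)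
    (cong₂ ℤ._+_ (coeff-⊗ c m′ q m) (coeff-* p q m))

  *-cong : ∀ {p p′ q q′} → p ≈ p′ → q ≈ q′ → p * q ≈ p′ * q′
  *-cong {p} {p′} {q} {q′} p≈ q≈ m = begin
    coeff (p * q) m                              ≡⟨ coeff-* p q m ⟩
    eval (λ m′ → coeff (shift m′ q) m) p         ≡⟨ eval-cong _ {p} {p′} p≈ ⟩
    eval (λ m′ → coeff (shift m′ q) m) p′        ≡⟨ eval-ext (λ m′ → shift-cong m′ {q} {q′} q≈ m) p′ ⟩
    eval (λ m′ → coeff (shift m′ q′) m) p′       ≡⟨ coeff-* p′ q′ m ⟨
    coeff (p′ * q′) m                            ∎
    where open ≡-Reasoning

  ^-cong : ∀ {p q} n → p ≈ q → p ^ n ≈ q ^ n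
  ^-cong         zero    p≈q = ≈-refl {1#}
  ^-cong {p} {q} (suc n) p≈q = *-cong {p} {q} {p ^ n} {q ^ n} p≈q (^-cong {p} {q} n p≈q)

open import Data.Nat.Base using (_+_; _*_; _∸_; _<_; z≤n; s≤s)

private variable
  A B : Set
  n k : ℕ

-- Sublists

sublists-⊑ : ∀ (xs : List A) → All (_⊑ xs) (sublists xs)
sublists-⊑ []       = [] ∷ []
sublists-⊑ (x ∷ xs) = All.++⁺ (All.map (x ∷ʳ_) (sublists-⊑ xs))
                              (All.map⁺ (All.map (refl ∷_) (sublists-⊑ xs)))

map-sublists-∷ : ∀ (f : List A → B) x xs →
  map f (sublists (x ∷ xs)) ≡ map f (sublists xs) ++ map (f ∘ (x ∷_)) (sublists xs)
map-sublists-∷ f x xs = trans (List.map-++ f (sublists xs) _)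
  (cong (map f (sublists xs) ++_) (sym (List.map-∘ (sublists xs))))

sublists-map : ∀ (f : A → B) xs → sublists (map f xs) ≡ map (map f) (sublists xs)
sublists-map f []       = refl
sublists-map f (x ∷ xs) = begin
  sublists (map f xs) ++ map (f x ∷_) (sublists (map f xs))
    ≡⟨ cong (λ yss → yss ++ map (f x ∷_) yss) (sublists-map f xs) ⟩
  map (map f) (sublists xs) ++ map (f x ∷_) (map (map f) (sublists xs))
    ≡⟨ cong (map (map f) (sublists xs) ++_) (List.map-∘ (sublists xs)) ⟨
  map (map f) (sublists xs) ++ map (λ ys → f x ∷ map f ys) (sublists xs)
    ≡⟨ map-sublists-∷ (map f) x xs ⟨
  map (map f) (sublists (x ∷ xs)) ∎
  where open ≡-Reasoning

All-removeAt : ∀ {P : A → Set} {xs} → All P xs → ∀ i → All P (removeAt xs i)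
All-removeAt (_ ∷ pxs)  zero    = pxs
All-removeAt (px ∷ pxs) (suc i) = px ∷ All-removeAt pxs i

↭-removeAt : ∀ (xs : List A) i → xs ↭ lookup xs i ∷ removeAt xs i
↭-removeAt (x ∷ xs) zero    = ↭-refl
↭-removeAt (x ∷ xs) (suc i) =
  ↭-trans (↭.prep x (↭-removeAt xs i)) (↭.swap x (lookup xs i) ↭-refl)

-- Splits the sum over `A` by whether `A` contains the chosen hyperedge. That hyperedge is moved to
-- the front of `A`, so `f` must be invariant under permutations; `P` restricts this to lists where
-- the invariance is available.
sublists-removeAt : ∀ {P : A → Set} (f : List A → B) →
  (∀ {ys zs} → All P ys → ys ↭ zs → f ys ≡ f zs) → ∀ xs i → All P xs →
  map f (sublists xs) ↭
    map f (sublists (removeAt xs i)) ++ map (f ∘ (lookup xs i ∷_)) (sublists (removeAt xs i))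
sublists-removeAt f inv (x ∷ xs) zero    pxs        = ↭-reflexive (map-sublists-∷ f x xs)
sublists-removeAt {P = P} f inv (x ∷ xs) (suc i) (px ∷ pxs) = begin
  map f (sublists (x ∷ xs))
    ≡⟨ map-sublists-∷ f x xs ⟩
  map f (sublists xs) ++ map (f ∘ (x ∷_)) (sublists xs)
    ↭⟨ ↭.++⁺ (sublists-removeAt f inv xs i pxs)
             (sublists-removeAt (f ∘ (x ∷_)) (λ pys ys↭zs → inv (px ∷ pys) (↭.prep x ys↭zs)) xs i pxs) ⟩
  (map f S ++ map (f ∘ (y ∷_)) S) ++ (map (f ∘ (x ∷_)) S ++ map (λ ys → f (x ∷ y ∷ ys)) S)
    ≡⟨ List.++-assoc (map f S) _ _ ⟩
  map f S ++ (map (f ∘ (y ∷_)) S ++ (map (f ∘ (x ∷_)) S ++ map (λ ys → f (x ∷ y ∷ ys)) S))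
    ↭⟨ ↭.++⁺ˡ (map f S) (↭.shifts (map (f ∘ (y ∷_)) S) (map (f ∘ (x ∷_)) S)) ⟩
  map f S ++ (map (f ∘ (x ∷_)) S ++ (map (f ∘ (y ∷_)) S ++ map (λ ys → f (x ∷ y ∷ ys)) S))
    ≡⟨ List.++-assoc (map f S) _ _ ⟨
  (map f S ++ map (f ∘ (x ∷_)) S) ++ (map (f ∘ (y ∷_)) S ++ map (λ ys → f (x ∷ y ∷ ys)) S)
    -- The lists with both `x` and `y` are the only ones whose order differs between the two
    -- groupings.
    ≡⟨ cong (λ l → (map f S ++ map (f ∘ (x ∷_)) S) ++ (map (f ∘ (y ∷_)) S ++ l))
         (List.map-cong-local (All.map swap (sublists-⊑ xs′))) ⟩
  (map f S ++ map (f ∘ (x ∷_)) S) ++ (map (f ∘ (y ∷_)) S ++ map (λ ys → f (y ∷ x ∷ ys)) S)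
    ≡⟨ cong₂ _++_ (map-sublists-∷ f x xs′) (map-sublists-∷ (f ∘ (y ∷_)) x xs′) ⟨
  map f (sublists (x ∷ xs′)) ++ map (f ∘ (y ∷_)) (sublists (x ∷ xs′)) ∎
  where
  open ↭.PermutationReasoning
  y = lookup xs i
  xs′ = removeAt xs i
  S = sublists xs′
  swap : ∀ {ys} → ys ⊑ xs′ → f (x ∷ y ∷ ys) ≡ f (y ∷ x ∷ ys)
  swap ys⊑ = inv (px ∷ All.lookup pxs (∈-lookup i)
                     ∷ All-resp-⊆ ys⊑ (All-removeAt pxs i)) (↭.swap x y ↭-refl)

-- Components

-- When the element found by `p` is removed, `q` is lost only if it points to that same element,
-- which then satisfies both predicates.
survives : ∀ {P Q : B → Set} {bs} (p : Any P bs) → Any Q bs →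
           (∃ λ b → P b × Q b) ⊎ Any Q (bs ─ p)
survives (here px) (here qx) = inj₁ (_ , px , qx)
survives (here px) (there q) = inj₂ q
survives (there p) (here qx) = inj₂ (here qx)
survives (there p) (there q) with survives p q
... | inj₁ both = inj₁ both
... | inj₂ q′   = inj₂ (there q′)

-- Each `x` uses up one `b` related to it: a later element needing the same `b` would be `R`-related
-- to `x`, so deleting `b` leaves partners for all the others.
pigeonhole : ∀ {R : Rel A 0ℓ} {P : A → B → Set} {as} bs → AllPairs (λ x y → ¬ R x y) as →
             (∀ {x y b} → P x b → P y b → R x y) →
             All (λ x → Any (P x) bs) as → length as ≤ length bs
pigeonhole bs []           join []       = z≤n
pigeonhole {R = R} {P = P} bs (x≁ ∷ as≁) join (p ∷ ps) =
  subst (_ ≤_) (sym (List.length-removeAt′ bs (Any.index p)))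
    (s≤s (pigeonhole (bs ─ p) as≁ join (rest x≁ ps)))
  where
  rest : ∀ {ys} → All (λ y → ¬ R _ y) ys → All (λ y → Any (P y) bs) ys →
         All (λ y → Any (P y) (bs ─ p)) ys
  rest [] [] = []
  rest (x≁y ∷ x≁) (q ∷ qs) with survives p q
  ... | inj₁ (_ , Px , Py) = contradiction (join Px Py) x≁y
  ... | inj₂ q′            = q′ ∷ rest x≁ qs

module _ (H : Hypergraph) where

  connectedDecSetoid : DecSetoid 0ℓ 0ℓ
  connectedDecSetoid = record
    { _≈_ = Connected H
    ; isDecEquivalence = record
        { isEquivalence = EqClosure.isEquivalence (Incident H) ; _≟_ = connected? H } }

  open DecSetoid connectedDecSetoid public using () renaming (sym to ~-sym)

  components : List (Node H)
  components = deduplicate (connected? H) (nodes H)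

  components-separated : AllPairs (λ x y → ¬ Connected H x y) components
  components-separated = DecSetoidUnique.deduplicate-! connectedDecSetoid (nodes H)

  ∈-component : ∀ x → Any (Connected H x) components
  ∈-component x = Any.deduplicate⁺ (connected? H) (λ y~z x~z → x~z ◅◅ ~-sym y~z)
                    (lose (∈-nodes H x) ε)

  -- With `components-separated`, this makes κ the largest number of pairwise unconnected nodes.
  separated⇒≤κ : ∀ {xs} → AllPairs (λ x y → ¬ Connected H x y) xs → length xs ≤ κ H
  separated⇒≤κ xs≁ = pigeonhole {P = Connected H} components xs≁
    (λ x~z y~z → x~z ◅◅ ~-sym y~z) (All.tabulate λ _ → ∈-component _)

~-reflexive : ∀ {H x y} → x ≡ y → Connected H x y
~-reflexive refl = ε

incident⇒~ : ∀ {H u e} → Vec.lookup (edge H e) u ≢ 0 → Connected H (inj₁ u) (inj₂ e)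
incident⇒~ u∈e = EqClosure.return u∈e

NonEmpty : Hyperedge n → Set
NonEmpty e = ∃ λ u → Vec.lookup e u ≢ 0

-- Since no hyperedge of H is empty, every component of H contains a vertex; f
-- sends inequivalent vertices to inequivalent nodes because g undoes it.
κ-≤ : ∀ {H H′} → All NonEmpty (edges H) → (f : Fin (v H) → Node H′) (g : Node H′ → Node H) →
      (∀ {x y} → Incident H′ x y → Connected H (g x) (g y)) →
      (∀ u → Connected H (g (f u)) (inj₁ u)) → κ H ≤ κ H′
κ-≤ {H} {H′} nonEmpty f g hom gf = begin
  κ H                               ≡⟨ List.length-map f′ (components H) ⟨
  length (map f′ (components H))    ≤⟨ separated⇒≤κ H′ (AllPairs.map⁺ (AllPairs.map reflects (components-separated H))) ⟩
  κ H′                              ∎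
  where
  open ℕ.≤-Reasoning
  vertexOf : ∀ x → ∃ λ u → Connected H (inj₁ u) x
  vertexOf (inj₁ u) = u , ε
  vertexOf (inj₂ e) = let u , u∈e = All.lookup nonEmpty (∈-lookup e) in u , incident⇒~ u∈e
  f′ : Node H → Node H′
  f′ = f ∘ proj₁ ∘ vertexOf
  gf′ : ∀ x → Connected H (g (f′ x)) x
  gf′ x = gf _ ◅◅ proj₂ (vertexOf x)
  reflects : ∀ {x y} → ¬ Connected H x y → ¬ Connected H′ (f′ x) (f′ y)
  reflects {x} {y} x≁y fx~fy = x≁y
    (~-sym H (gf′ x) ◅◅ EqClosure.gfold (EqClosure.isEquivalence (Incident H)) g hom fx~fy ◅◅ gf′ y)

∈⇒E : ∀ {H e} → e ∈ˡ edges H → ∃ λ i → e ≡ edge H i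
∈⇒E e∈ = Any.index e∈ , Any.lookup-index e∈

-- Inclusion of members suffices, since sending a hyperedge to any equal copy preserves incidence.
-- An empty hyperedge in `es′` would be a component of its own, hence `NonEmpty`.
κ-anti : ∀ {es es′ : List (Hyperedge n)} → es ⊆ˡ es′ → All NonEmpty es′ →
         κ (hypergraph n es′) ≤ κ (hypergraph n es)
κ-anti {n} {es} {es′} es⊆ nonEmpty =
  κ-≤ {hypergraph n es′} {hypergraph n es} nonEmpty inj₁ g hom (λ _ → ε)
  where
  position : (i : Fin (length es)) → ∃ λ j → lookup es i ≡ lookup es′ j
  position i = ∈⇒E {hypergraph n es′} (es⊆ (∈-lookup i))
  g : Node (hypergraph n es) → Node (hypergraph n es′)
  g (inj₁ u) = inj₁ u
  g (inj₂ i) = inj₂ (proj₁ (position i))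
  hom : ∀ {x y} → Incident (hypergraph n es) x y → Connected (hypergraph n es′) (g x) (g y)
  hom {inj₁ u} {inj₂ i} u∈i = incident⇒~ (subst (λ e → Vec.lookup e u ≢ 0) (proj₂ (position i)) u∈i)
  hom {inj₁ _} {inj₁ _} ()
  hom {inj₂ _} ()

κ-↭ : ∀ {es es′ : List (Hyperedge n)} → es ↭ es′ → All NonEmpty es →
      κ (hypergraph n es) ≡ κ (hypergraph n es′)
κ-↭ es↭ nonEmpty = ℕ.≤-antisym (κ-anti (↭.∈-resp-↭ (↭-sym es↭)) nonEmpty)
  (κ-anti (↭.∈-resp-↭ es↭) (All-resp-⊇ (↭.∈-resp-↭ (↭-sym es↭)) nonEmpty))

κ-edgeless : ∀ n → κ (hypergraph n []) ≡ n
κ-edgeless n = ℕ.≤-antisym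
  (begin
    κ H                                 ≤⟨ List.length-deduplicate (connected? H) (nodes H) ⟩
    length (nodes H)                    ≡⟨ cong length (List.++-identityʳ (map inj₁ (allFin n))) ⟩
    length (map {B = Node H} inj₁ (allFin n))  ≡⟨ List.length-map _ (allFin n) ⟩
    length (allFin n)                   ≡⟨ List.length-tabulate id ⟩
    n                                   ∎)
  (begin
    n                                   ≡⟨ List.length-tabulate id ⟨
    length (allFin n)                   ≡⟨ List.length-map _ (allFin n) ⟨
    length (map {B = Node H} inj₁ (allFin n))  ≤⟨ separated⇒≤κ H (AllPairs.map⁺ (AllPairs.map isolated (allFin⁺ n))) ⟩
    κ H                                 ∎)
  where
  open ℕ.≤-Reasoning
  H = hypergraph n []
  isolated : ∀ {u w} → u ≢ w → ¬ Connected H (inj₁ u) (inj₁ w)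
  isolated u≢w ε = u≢w refl
  isolated u≢w (_◅_ {j = inj₁ _} (fwd ()) _)
  isolated u≢w (_◅_ {j = inj₁ _} (bwd ()) _)
  isolated u≢w (_◅_ {j = inj₂ ()} _ _)

-- Contraction and components

pick : (e : Hyperedge n) → Fin (outside e) → Fin n
pick (zero  ∷ e) zero    = zero
pick (zero  ∷ e) (suc j) = suc (pick e j)
pick (suc _ ∷ e) j       = suc (pick e j)

pick∉ : ∀ (e : Hyperedge n) j → Vec.lookup e (pick e j) ≡ 0
pick∉ (zero  ∷ e) zero    = refl
pick∉ (zero  ∷ e) (suc j) = pick∉ e j
pick∉ (suc _ ∷ e) j       = pick∉ e j

pick-injective : ∀ (e : Hyperedge n) {i j} → pick e i ≡ pick e j → i ≡ j
pick-injective (zero  ∷ e) {zero}  {zero}  _  = refl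
pick-injective (zero  ∷ e) {suc i} {suc j} eq = cong suc (pick-injective e (suc-injective eq))
pick-injective (suc _ ∷ e)                 eq = pick-injective e (suc-injective eq)

inside? : ∀ (e : Hyperedge n) u → Vec.lookup e u ≢ 0 ⊎ ∃ λ j → pick e j ≡ u
inside? (zero  ∷ e) zero    = inj₂ (zero , refl)
inside? (suc _ ∷ e) zero    = inj₁ λ ()
inside? (zero  ∷ e) (suc u) with inside? e u
... | inj₁ u∈e        = inj₁ u∈e
... | inj₂ (j , refl) = inj₂ (suc j , refl)
inside? (suc _ ∷ e) (suc u) with inside? e u
... | inj₁ u∈e        = inj₁ u∈e
... | inj₂ (j , refl) = inj₂ (j , refl)

lookup-restrict : ∀ (e f : Hyperedge n) j → Vec.lookup (restrict e f) j ≡ Vec.lookup f (pick e j)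
lookup-restrict (zero  ∷ e) (_ ∷ f) zero    = refl
lookup-restrict (zero  ∷ e) (_ ∷ f) (suc j) = lookup-restrict e f j
lookup-restrict (suc _ ∷ e) (_ ∷ f) j       = lookup-restrict e f j

hits⁺ : ∀ (e f : Hyperedge n) u → Vec.lookup e u ≢ 0 → Vec.lookup f u ≢ 0 → hits e f ≢ 0
hits⁺ (zero  ∷ e) (c ∷ f) zero    u∈e u∈f _  = u∈e refl
hits⁺ (suc _ ∷ e) (c ∷ f) zero    u∈e u∈f eq = u∈f (ℕ.m+n≡0⇒m≡0 c eq)
hits⁺ (zero  ∷ e) (c ∷ f) (suc u) u∈e u∈f eq = hits⁺ e f u u∈e u∈f eq
hits⁺ (suc _ ∷ e) (c ∷ f) (suc u) u∈e u∈f eq = hits⁺ e f u u∈e u∈f (ℕ.m+n≡0⇒n≡0 c eq)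

hits⁻ : ∀ (e f : Hyperedge n) → hits e f ≢ 0 → ∃ λ u → Vec.lookup e u ≢ 0 × Vec.lookup f u ≢ 0
hits⁻ []          []          h = contradiction refl h
hits⁻ (zero  ∷ e) (c     ∷ f) h = let u , p = hits⁻ e f h in suc u , p
hits⁻ (suc _ ∷ e) (zero  ∷ f) h = let u , p = hits⁻ e f h in suc u , p
hits⁻ (suc _ ∷ e) (suc _ ∷ f) h = zero , (λ ()) , (λ ())

-- The quotient map from V to the vertices of H/e; `pick` is its section over the vertices outside
-- `e`.
place : (e : Hyperedge n) → Fin n → Fin (suc (outside e))
place e u = [ (λ _ → zero) , suc ∘ proj₁ ]′ (inside? e u)

place-∈ : ∀ (e : Hyperedge n) u → Vec.lookup e u ≢ 0 → place e u ≡ zero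
place-∈ e u u∈e with inside? e u
... | inj₁ _          = refl
... | inj₂ (j , refl) = contradiction (pick∉ e j) u∈e

place-pick : ∀ (e : Hyperedge n) j → place e (pick e j) ≡ suc j
place-pick e j with inside? e (pick e j)
... | inj₁ ∈e       = contradiction (pick∉ e j) ∈e
... | inj₂ (_ , eq) = cong suc (pick-injective e eq)

contractEdge-∈ : ∀ (e f : Hyperedge n) u → Vec.lookup f u ≢ 0 →
                 Vec.lookup (contractEdge e f) (place e u) ≢ 0
contractEdge-∈ e f u u∈f with inside? e u
... | inj₁ u∈e        = hits⁺ e f u u∈e u∈f
... | inj₂ (j , refl) = u∈f ∘ trans (sym (lookup-restrict e f j))

-- The incidence graph of H/e arises by collapsing the node `e` and its vertices to one point. The
-- two maps below are mutually inverse on vertices up to connectedness, and `κ-≤` applies in both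
-- directions.
κ-contract : ∀ {e : Hyperedge n} {es} → All NonEmpty (e ∷ es) →
             κ (hypergraph n (e ∷ es)) ≡ κ (hypergraph (suc (outside e)) (map (contractEdge e) es))
κ-contract {n} {e} {es} nonEmpty@(_ ∷ nonEmptyₛ) = ℕ.≤-antisym
  (κ-≤ {H} {H′} nonEmpty (inj₁ ∘ place e) expand expand-hom expand-place)
  (κ-≤ {H′} {H} nonEmpty′ (expand ∘ inj₁) contract contract-hom contract-expand)
  where
  H H′ : Hypergraph
  H = hypergraph n (e ∷ es)
  H′ = hypergraph (suc (outside e)) (map (contractEdge e) es)

  nonEmpty′ : All NonEmpty (edges H′)
  nonEmpty′ = All.map⁺ (All.map (λ {f} (u , u∈f) → place e u , contractEdge-∈ e f u u∈f) nonEmptyₛ)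

  origin : (i : E H′) → ∃ λ j → edge H′ i ≡ contractEdge e (lookup es j)
  origin i with ∈-map⁻ (contractEdge e) (∈-lookup {xs = map (contractEdge e) es} i)
  ... | f , f∈es , eq = Any.index f∈es , trans eq (cong (contractEdge e) (Any.lookup-index f∈es))

  image : (j : Fin (length es)) → ∃ λ i → contractEdge e (lookup es j) ≡ edge H′ i
  image j = ∈⇒E {H′} (∈-map⁺ (contractEdge e) (∈-lookup j))

  expand : Node H′ → Node H
  -- The new vertex corresponds to the node of `e` itself, so no vertex of `e` has to be chosen.
  expand (inj₁ zero)    = inj₂ zero
  expand (inj₁ (suc j)) = inj₁ (pick e j)
  expand (inj₂ i)       = inj₂ (suc (proj₁ (origin i)))

  expand-hom : ∀ {x y} → Incident H′ x y → Connected H (expand x) (expand y)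
  -- A hyperedge through the new vertex came from one sharing a vertex `u` with `e`, and the walk
  -- goes through `u`.
  expand-hom {inj₁ zero} {inj₂ i} w∈i =
    let j , eq = origin i
        u , u∈e , u∈f = hits⁻ e (lookup es j) (subst (λ f → Vec.lookup f zero ≢ 0) eq w∈i)
    in ~-sym H (incident⇒~ {H} {u} {zero} u∈e) ◅◅ incident⇒~ {H} {u} {suc j} u∈f
  expand-hom {inj₁ (suc p)} {inj₂ i} w∈i =
    let j , eq = origin i
    in incident⇒~ {H} {pick e p} {suc j} (subst (λ f → Vec.lookup f (suc p) ≢ 0) eq w∈i
                                           ∘ trans (lookup-restrict e (lookup es j) p))
  expand-hom {inj₁ _} {inj₁ _} ()
  expand-hom {inj₂ _} ()

  expand-place : ∀ u → Connected H (expand (inj₁ (place e u))) (inj₁ u)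
  expand-place u with inside? e u
  ... | inj₁ u∈e        = ~-sym H (incident⇒~ {H} {u} {zero} u∈e)
  ... | inj₂ (j , refl) = ε

  contract : Node H → Node H′
  contract (inj₁ u)       = inj₁ (place e u)
  contract (inj₂ zero)    = inj₁ zero
  contract (inj₂ (suc j)) = inj₂ (proj₁ (image j))

  contract-hom : ∀ {x y} → Incident H x y → Connected H′ (contract x) (contract y)
  contract-hom {inj₁ u} {inj₂ zero}    u∈e = ~-reflexive (cong inj₁ (place-∈ e u u∈e))
  contract-hom {inj₁ u} {inj₂ (suc j)} u∈f = incident⇒~ {H′} {place e u} {proj₁ (image j)}
    (subst (λ f → Vec.lookup f (place e u) ≢ 0) (proj₂ (image j)) (contractEdge-∈ e (lookup es j) u u∈f))
  contract-hom {inj₁ _} {inj₁ _} ()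
  contract-hom {inj₂ _} ()

  contract-expand : ∀ w → Connected H′ (contract (expand (inj₁ w))) (inj₁ w)
  contract-expand zero    = ε
  contract-expand (suc j) = ~-reflexive (cong inj₁ (place-pick e j))

-- Deletion and components

support : Hyperedge n → List (Fin n)
support []          = []
support (zero  ∷ e) = map suc (support e)
support (suc _ ∷ e) = zero ∷ map suc (support e)

length-support : ∀ (e : Hyperedge n) → length (support e) ≡ vₑ e
length-support []          = refl
length-support (zero  ∷ e) = trans (List.length-map suc (support e)) (length-support e)
length-support (suc _ ∷ e) = cong suc (trans (List.length-map suc (support e)) (length-support e))

∈-support : ∀ (e : Hyperedge n) {u} → Vec.lookup e u ≢ 0 → u ∈ˡ support e
∈-support (zero  ∷ e) {zero}  u∈e = contradiction refl u∈e
∈-support (zero  ∷ e) {suc u} u∈e = ∈-map⁺ suc (∈-support e u∈e)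
∈-support (suc _ ∷ e) {zero}  u∈e = here refl
∈-support (suc _ ∷ e) {suc u} u∈e = there (∈-map⁺ suc (∈-support e u∈e))

-- Each component of (V, es) either meets one of the vₑ e vertices of e or is a
-- component of (V, e ∷ es) other than that of e.
κ-delete : ∀ {e : Hyperedge n} {es} → NonEmpty e →
           κ (hypergraph n es) < κ (hypergraph n (e ∷ es)) + vₑ e
κ-delete {n} {e} {es} (u₀ , u₀∈e) = begin-strict
  κ H₀
    ≤⟨ pigeonhole {P = Connected H₀} (touching ++ avoiding) (components-separated H₀)
         (λ x~z y~z → x~z ◅◅ ~-sym H₀ y~z) (All.tabulate λ _ → covered _) ⟩
  length (touching ++ avoiding)
    ≡⟨ List.length-++ touching ⟩
  length touching + length avoiding
    ≡⟨ cong₂ _+_ (trans (List.length-map _ (support e)) (length-support e)) (List.length-map back avoiding′) ⟩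
  vₑ e + length avoiding′
    -- Strict because the representative of the component of `e` is filtered out.
    <⟨ ℕ.+-monoʳ-< (vₑ e) (List.filter-notAll avoids? (components H₁)
         (Any.map (λ e~x e≁x → e≁x e~x) (∈-component H₁ (inj₂ zero)))) ⟩
  vₑ e + κ H₁
    ≡⟨ ℕ.+-comm (vₑ e) (κ H₁) ⟩
  κ H₁ + vₑ e ∎
  where
  open ℕ.≤-Reasoning
  H₀ H₁ : Hypergraph
  H₀ = hypergraph n es
  H₁ = hypergraph n (e ∷ es)

  back : Node H₁ → Node H₀
  back (inj₁ u)       = inj₁ u
  -- The node `e` is missing from `H₀`; a vertex of `e` stands in for it.
  back (inj₂ zero)    = inj₁ u₀
  back (inj₂ (suc i)) = inj₂ i

  forth : Node H₀ → Node H₁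
  forth (inj₁ u) = inj₁ u
  forth (inj₂ i) = inj₂ (suc i)

  back-forth : ∀ x → back (forth x) ≡ x
  back-forth (inj₁ _) = refl
  back-forth (inj₂ _) = refl

  avoids? : ∀ x → _
  avoids? x = ¬? (connected? H₁ (inj₂ zero) x)

  avoiding′ : List (Node H₁)
  avoiding′ = filter avoids? (components H₁)

  touching avoiding : List (Node H₀)
  touching = map inj₁ (support e)
  avoiding = map back avoiding′

  Touches : Node H₀ → Set
  Touches x = ∃ λ u → Vec.lookup e u ≢ 0 × Connected H₀ x (inj₁ u)

  -- A walk in `H₁` can be followed in `H₀` until it first meets the node `e`, and there a vertex of
  -- `e` has been reached.
  reroute : ∀ {x y} → Connected H₁ x y → Connected H₀ (back x) (back y) ⊎ Touches (back x)
  reroute ε = inj₁ ε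
  reroute {inj₂ zero} (_ ◅ _) = inj₂ (u₀ , u₀∈e , ε)
  reroute (_◅_ {inj₁ u} {inj₂ zero} (fwd u∈e) _) = inj₂ (u , u∈e , ε)
  reroute (_◅_ {inj₁ u} {inj₂ (suc i)} (fwd u∈i) r) with reroute r
  ... | inj₁ q             = inj₁ (fwd u∈i ◅ q)
  ... | inj₂ (w , w∈e , q) = inj₂ (w , w∈e , fwd u∈i ◅ q)
  reroute (_◅_ {inj₂ (suc i)} {inj₁ u} (bwd u∈i) r) with reroute r
  ... | inj₁ q             = inj₁ (bwd u∈i ◅ q)
  ... | inj₂ (w , w∈e , q) = inj₂ (w , w∈e , bwd u∈i ◅ q)
  reroute (_◅_ {inj₁ _} {inj₁ _} (fwd ()) _)
  reroute (_◅_ {inj₁ _} {inj₁ _} (bwd ()) _)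
  reroute (_◅_ {inj₁ _} {inj₂ _} (bwd ()) _)
  reroute (_◅_ {inj₂ (suc _)} {inj₁ _} (fwd ()) _)
  reroute (_◅_ {inj₂ (suc _)} {inj₂ _} (fwd ()) _)
  reroute (_◅_ {inj₂ (suc _)} {inj₂ _} (bwd ()) _)

  Covered : Node H₀ → Set
  Covered x = Any (Connected H₀ x) (touching ++ avoiding)

  touches⇒covered : ∀ {x} → Touches x → Covered x
  touches⇒covered (u , u∈e , x~u) = lose (∈-++⁺ˡ (∈-map⁺ inj₁ (∈-support e u∈e))) x~u

  forth-covered : ∀ {x y} → y ∈ˡ components H₁ → Connected H₁ x y → Covered (back x)
  forth-covered {x} {y} y∈ x~y with reroute x~y | connected? H₁ (inj₂ zero) y
  ... | inj₂ t | _       = touches⇒covered t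
  ... | inj₁ q | no  e≁y = lose (∈-++⁺ʳ touching (∈-map⁺ back (∈-filter⁺ avoids? y∈ e≁y))) q
  -- Here `x` is connected to `e` in `H₁`. As `back` sends `e` to `u₀`, either outcome of rerouting
  -- that walk reaches a vertex of `e`.
  ... | inj₁ q | yes e~y with reroute (x~y ◅◅ ~-sym H₁ e~y)
  ...   | inj₁ r = touches⇒covered (u₀ , u₀∈e , r)
  ...   | inj₂ t = touches⇒covered t

  covered : ∀ x → Covered x
  covered x = subst Covered (back-forth x) (forth-covered (∈-lookup (Any.index p)) (Any.lookup-index p))
    where p = ∈-component H₁ (forth x)

-- Bounds for uniform hypergraphs

outside+vₑ : ∀ (e : Hyperedge n) → outside e + vₑ e ≡ n
outside+vₑ []          = refl
outside+vₑ (zero  ∷ e) = cong suc (outside+vₑ e)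
outside+vₑ (suc _ ∷ e) = trans (ℕ.+-suc (outside e) (vₑ e)) (cong suc (outside+vₑ e))

vₑ≤dₑ : ∀ (e : Hyperedge n) → vₑ e ≤ dₑ e
vₑ≤dₑ []          = z≤n
vₑ≤dₑ (zero  ∷ e) = vₑ≤dₑ e
vₑ≤dₑ (suc c ∷ e) = s≤s (ℕ.≤-trans (vₑ≤dₑ e) (ℕ.m≤n+m (dₑ e) c))

vₑ>0 : ∀ (e : Hyperedge n) → NonEmpty e → 1 ≤ vₑ e
vₑ>0 (zero  ∷ e) (zero  , u∈e) = contradiction refl u∈e
vₑ>0 (zero  ∷ e) (suc u , u∈e) = vₑ>0 e (u , u∈e)
vₑ>0 (suc _ ∷ e) _             = s≤s z≤n

dₑ-contractEdge : ∀ (e f : Hyperedge n) → dₑ (contractEdge e f) ≡ dₑ f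
dₑ-contractEdge []          []      = refl
dₑ-contractEdge (zero  ∷ e) (c ∷ f) = begin
  hits e f + (c + dₑ (restrict e f))    ≡⟨ ℕ.+-comm (hits e f) _ ⟩
  c + dₑ (restrict e f) + hits e f      ≡⟨ ℕ.+-assoc c _ _ ⟩
  c + (dₑ (restrict e f) + hits e f)    ≡⟨ cong (c +_) (ℕ.+-comm _ (hits e f)) ⟩
  c + dₑ (contractEdge e f)             ≡⟨ cong (c +_) (dₑ-contractEdge e f) ⟩
  c + dₑ f                              ∎
  where open ≡-Reasoning
dₑ-contractEdge (suc _ ∷ e) (c ∷ f) =
  trans (ℕ.+-assoc c (hits e f) _) (cong (c +_) (dₑ-contractEdge e f))

-- A record, so that e can be inferred from the type.
record Sized (k : ℕ) (e : Hyperedge n) : Set where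
  constructor sized
  field size : dₑ e ≡ suc k

sized⇒nonEmpty : ∀ {e : Hyperedge n} → Sized k e → NonEmpty e
sized⇒nonEmpty {e = zero  ∷ e} (sized d≡) = let u , u∈e = sized⇒nonEmpty {e = e} (sized d≡) in suc u , u∈e
sized⇒nonEmpty {e = suc _ ∷ e} _          = zero , λ ()

vₑ≤1+k : ∀ {e : Hyperedge n} → Sized k e → vₑ e ≤ suc k
vₑ≤1+k {e = e} (sized d≡) = ℕ.≤-trans (vₑ≤dₑ e) (ℕ.≤-reflexive d≡)

uniform⇒sized : ∀ {H} → Uniform (suc k) H → All (Sized k) (edges H)
uniform⇒sized {k} {H} uniform = All.tabulate λ e∈ →
  subst (Sized k) (sym (Any.lookup-index e∈)) (sized (uniform (Any.index e∈)))

sum-sized : ∀ {es : List (Hyperedge n)} → All (Sized k) es → sum (map dₑ es) ≡ suc k * length es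
sum-sized {k = k} []                    = sym (ℕ.*-zeroʳ k)
sum-sized {k = k} {_ ∷ es} (sized d≡ ∷ es✓) =
  trans (cong₂ _+_ d≡ (sum-sized es✓)) (sym (ℕ.*-suc (suc k) (length es)))

-- The bound Δ(e) ≤ k, written without subtraction.
κ-delete-sized : ∀ {e : Hyperedge n} {es} → Sized k e →
                 κ (hypergraph n es) ≤ κ (hypergraph n (e ∷ es)) + k
κ-delete-sized {n} {k} {e} {es} e✓ = ℕ.≤-pred (begin
  suc (κ (hypergraph n es))                 ≤⟨ κ-delete {e = e} (sized⇒nonEmpty e✓) ⟩
  κ (hypergraph n (e ∷ es)) + vₑ e          ≤⟨ ℕ.+-monoʳ-≤ (κ (hypergraph n (e ∷ es))) (vₑ≤1+k e✓) ⟩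
  κ (hypergraph n (e ∷ es)) + suc k         ≡⟨ ℕ.+-suc (κ (hypergraph n (e ∷ es))) k ⟩
  suc (κ (hypergraph n (e ∷ es)) + k)       ∎)
  where open ℕ.≤-Reasoning

-- C collects the members of A that the induction has passed, so that only
-- hyperedges outside A are ever deleted.
κ-⊑-++ : ∀ {A es : List (Hyperedge n)} → All (Sized k) es → A ⊑ es → ∀ C → All (Sized k) C →
         κ (hypergraph n (A ++ C)) + k * length A ≤ κ (hypergraph n (es ++ C)) + k * length es
κ-⊑-++ [] [] C C✓ = ℕ.≤-refl
κ-⊑-++ {n} {k} {A} {e ∷ es} (e✓ ∷ es✓) (e ∷ʳ A⊑es) C C✓ = begin
  κ (hypergraph n (A ++ C)) + k * length A             ≤⟨ κ-⊑-++ es✓ A⊑es C C✓ ⟩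
  κ (hypergraph n (es ++ C)) + k * length es           ≤⟨ ℕ.+-monoˡ-≤ (k * length es) (κ-delete-sized e✓) ⟩
  κ (hypergraph n (e ∷ es ++ C)) + k + k * length es   ≡⟨ ℕ.+-assoc (κ (hypergraph n (e ∷ es ++ C))) k (k * length es) ⟩
  κ (hypergraph n (e ∷ es ++ C)) + (k + k * length es) ≡⟨ cong (κ (hypergraph n (e ∷ es ++ C)) +_) (ℕ.*-suc k (length es)) ⟨
  κ (hypergraph n (e ∷ es ++ C)) + k * suc (length es) ∎
  where open ℕ.≤-Reasoning
κ-⊑-++ {n} {k} {e ∷ A} {e ∷ es} (e✓ ∷ es✓) (refl ∷ A⊑es) C C✓ = begin
  κ (hypergraph n (e ∷ A ++ C)) + k * suc (length A)   ≡⟨ move A (All-resp-⊆ A⊑es es✓) ⟩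
  κ (hypergraph n (A ++ e ∷ C)) + k * length A + k     ≤⟨ ℕ.+-monoˡ-≤ k (κ-⊑-++ es✓ A⊑es (e ∷ C) (e✓ ∷ C✓)) ⟩
  κ (hypergraph n (es ++ e ∷ C)) + k * length es + k   ≡⟨ move es es✓ ⟨
  κ (hypergraph n (e ∷ es ++ C)) + k * suc (length es) ∎
  where
  open ℕ.≤-Reasoning
  move : ∀ B → All (Sized k) B → κ (hypergraph n (e ∷ B ++ C)) + k * suc (length B)
                               ≡ κ (hypergraph n (B ++ e ∷ C)) + k * length B + k
  move B B✓ = begin-equality
    κ (hypergraph n (e ∷ B ++ C)) + k * suc (length B)     ≡⟨ cong₂ _+_
      (κ-↭ (↭-sym (↭.shift e B C)) (All.map sized⇒nonEmpty (e✓ ∷ All.++⁺ B✓ C✓)))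
      (trans (ℕ.*-suc k (length B)) (ℕ.+-comm k _)) ⟩
    κ (hypergraph n (B ++ e ∷ C)) + (k * length B + k)     ≡⟨ ℕ.+-assoc (κ (hypergraph n (B ++ e ∷ C))) (k * length B) k ⟨
    κ (hypergraph n (B ++ e ∷ C)) + k * length B + k       ∎

module _ {A es : List (Hyperedge n)} (es✓ : All (Sized k) es) (A⊑es : A ⊑ es) where

  κ-⊑ : κ (hypergraph n es) ≤ κ (hypergraph n A)
  κ-⊑ = κ-anti (Sublist.lookup A⊑es) (All.map sized⇒nonEmpty es✓)

  -- After subtracting `n`, this compares the cyclomatic numbers of two incidence graphs. It makes
  -- the exponent of `a` nonnegative.
  κ-⊑-bound : k * length A + κ (hypergraph n A) ≤ k * length es + κ (hypergraph n es)
  κ-⊑-bound = begin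
    k * length A + κ (hypergraph n A)            ≡⟨ ℕ.+-comm (k * length A) (κ (hypergraph n A)) ⟩
    κ (hypergraph n A) + k * length A            ≡⟨ cong (λ B → κ (hypergraph n B) + k * length A) (List.++-identityʳ A) ⟨
    κ (hypergraph n (A ++ [])) + k * length A    ≤⟨ κ-⊑-++ es✓ A⊑es [] [] ⟩
    κ (hypergraph n (es ++ [])) + k * length es  ≡⟨ cong (λ B → κ (hypergraph n B) + k * length es) (List.++-identityʳ es) ⟩
    κ (hypergraph n es) + k * length es          ≡⟨ ℕ.+-comm (κ (hypergraph n es)) (k * length es) ⟩
    k * length es + κ (hypergraph n es)          ∎
    where open ℕ.≤-Reasoning

κ≤v : ∀ {es : List (Hyperedge n)} → All (Sized k) es → κ (hypergraph n es) ≤ n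
κ≤v {n} {es = es} es✓ = subst (κ (hypergraph n es) ≤_) (κ-edgeless n) (κ-⊑ es✓ (minimum es))

-- The comparison with the empty set of hyperedges, which has κ = n: a cyclomatic number is
-- nonnegative.
v≤κ : ∀ {es : List (Hyperedge n)} → All (Sized k) es → n ≤ k * length es + κ (hypergraph n es)
v≤κ {n} {k} {es} es✓ = begin
  n                                     ≡⟨ κ-edgeless n ⟨
  κ (hypergraph n [])                   ≡⟨ cong (_+ κ (hypergraph n [])) (ℕ.*-zeroʳ k) ⟨
  k * 0 + κ (hypergraph n [])           ≤⟨ κ-⊑-bound es✓ (minimum es) ⟩
  k * length es + κ (hypergraph n es)   ∎
  where open ℕ.≤-Reasoning

-- Exponents

∸-telescope : ∀ {i j l} → i ≤ j → j ≤ l → (l ∸ j) + (j ∸ i) ≡ l ∸ i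
∸-telescope {i} {j} {l} i≤j j≤l =
  trans (sym (ℕ.+-∸-assoc (l ∸ j) i≤j)) (cong (_∸ i) (ℕ.m∸n+n≡m j≤l))

+-≡⇒∸-≡ : ∀ {p q r} → r + q ≡ p → r ≡ p ∸ q
+-≡⇒∸-≡ {q = q} {r} refl = sym (ℕ.m+n∸n≡m r q)

-- Here `s` counts the remaining hyperedges and `t` is k|A| + κ(A). The Δ = κ′ - κ missing from the
-- weight is regained in κ′.
deletion-a : ∀ {k κ κ′} s {t} → κ ≤ κ′ → κ′ ≤ κ + k → t ≤ k * s + κ′ →
             (k ∸ (κ′ ∸ κ)) + ((k * s + κ′) ∸ t) ≡ (k * suc s + κ) ∸ t
deletion-a {k} {κ} {κ′} s {t} κ≤κ′ κ′≤κ+k t≤ = +-≡⇒∸-≡ (begin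
  c + ((k * s + κ′) ∸ t) + t      ≡⟨ ℕ.+-assoc c _ t ⟩
  c + (((k * s + κ′) ∸ t) + t)    ≡⟨ cong (c +_) (ℕ.m∸n+n≡m t≤) ⟩
  c + (k * s + κ′)                ≡⟨ cong (λ l → c + (k * s + l)) (ℕ.m∸n+n≡m κ≤κ′) ⟨
  c + (k * s + (κ′ ∸ κ + κ))      ≡⟨ rearrange c (k * s) (κ′ ∸ κ) κ ⟩
  (c + (κ′ ∸ κ)) + k * s + κ      ≡⟨ cong (λ l → l + k * s + κ) (ℕ.m∸n+n≡m (ℕ.m≤n+o⇒m∸n≤o κ′ κ κ′≤κ+k)) ⟩
  k + k * s + κ                   ≡⟨ cong (_+ κ) (ℕ.*-suc k s) ⟨
  k * suc s + κ                   ∎)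
  where
  open ≡-Reasoning
  c = k ∸ (κ′ ∸ κ)
  rearrange : ∀ c s d κ → c + (s + (d + κ)) ≡ (c + d) + s + κ
  rearrange = solve-∀

-- Contraction costs `A` one hyperedge, worth `k`, and merges `v` vertices into one, which returns v
-- - 1; the difference is m(e).
contraction-y : ∀ {k v o n} s {c} → v ≤ suc k → o + v ≡ n → suc o ≤ k * s + c →
                (suc k ∸ v) + ((k * s + c) ∸ suc o) ≡ (k * suc s + c) ∸ n
-- Adding 1 to both sides lets `suc k ∸ v` and the subtraction of `suc o` each be undone whole.
contraction-y {k} {v} {o} s {c} v≤ refl o< = +-≡⇒∸-≡ (ℕ.suc-injective (begin
  suc (m + r + (o + v))     ≡⟨ rearrange m r o v ⟩
  (m + v) + (r + suc o)     ≡⟨ cong₂ _+_ (ℕ.m∸n+n≡m v≤) (ℕ.m∸n+n≡m o<) ⟩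
  suc (k + (k * s + c))     ≡⟨ cong suc (ℕ.+-assoc k (k * s) c) ⟨
  suc (k + k * s + c)       ≡⟨ cong (λ l → suc (l + c)) (ℕ.*-suc k s) ⟨
  suc (k * suc s + c)       ∎))
  where
  open ≡-Reasoning
  m = suc k ∸ v
  r = (k * s + c) ∸ suc o
  rearrange : ∀ m r o v → suc (m + r + (o + v)) ≡ (m + v) + (r + suc o)
  rearrange = solve-∀

contraction-a : ∀ k s κ a c → (k * s + κ) ∸ (k * a + c) ≡ (k * suc s + κ) ∸ (k * suc a + c)
contraction-a k s κ a c = begin
  (k * s + κ) ∸ (k * a + c)                 ≡⟨ ℕ.[m+n]∸[m+o]≡n∸o k _ _ ⟨
  (k + (k * s + κ)) ∸ (k + (k * a + c))     ≡⟨ cong₂ _∸_ (+*-suc s κ) (+*-suc a c) ⟩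
  (k * suc s + κ) ∸ (k * suc a + c)         ∎
  where
  open ≡-Reasoning
  +*-suc : ∀ s t → k + (k * s + t) ≡ k * suc s + t
  +*-suc s t = trans (sym (ℕ.+-assoc k (k * s) t)) (cong (_+ t) (sym (ℕ.*-suc k s)))

-- k - m(e) equals v - 1, the number of vertices lost in the contraction.
contraction-b : ∀ {k v o n c} → 1 ≤ v → v ≤ suc k → o + v ≡ n → c ≤ suc o →
                (k ∸ (suc k ∸ v)) + (suc o ∸ c) ≡ n ∸ c
contraction-b {k} {suc w} {o} {c = c} _ (s≤s w≤k) refl c≤ = begin
  (k ∸ (k ∸ w)) + (suc o ∸ c)    ≡⟨ cong (_+ (suc o ∸ c)) (ℕ.m∸[m∸n]≡n w≤k) ⟩
  w + (suc o ∸ c)                ≡⟨ ℕ.+-∸-assoc w c≤ ⟨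
  (w + suc o) ∸ c                ≡⟨ cong (_∸ c) (trans (ℕ.+-comm w (suc o)) (sym (ℕ.+-suc o w))) ⟩
  (o + suc w) ∸ c                ∎
  where open ≡-Reasoning

vec-≡ : ∀ {X : Set} {p₁ p₂ p₃ p₄ p₅ q₁ q₂ q₃ q₄ q₅ : X} →
        p₁ ≡ q₁ → p₂ ≡ q₂ → p₃ ≡ q₃ → p₄ ≡ q₄ → p₅ ≡ q₅ →
        _≡_ {A = Vec X 5} (p₁ ∷ p₂ ∷ p₃ ∷ p₄ ∷ p₅ ∷ []) (q₁ ∷ q₂ ∷ q₃ ∷ q₄ ∷ q₅ ∷ [])
vec-≡ refl refl refl refl refl = refl

-- The exponents of x, y, α, a, b in the term of A, where s = |E| and a = |A|; the
-- fourth is k(|E|-|A|) - (κ(A)-κ(H)) with both sides moved.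
exponentVector : (k n s κH a κA : ℕ) → Vec ℕ 5
exponentVector k n s κH a κA =
    κA ∸ κH
  ∷ (k * a + κA) ∸ n
  ∷ κA
  ∷ (k * s + κH) ∸ (k * a + κA)
  ∷ n ∸ κA
  ∷ []

exponentVector-cong : ∀ {k n s s′ κH κH′ a a′ κA κA′} → s ≡ s′ → κH ≡ κH′ → a ≡ a′ → κA ≡ κA′ →
                      exponentVector k n s κH a κA ≡ exponentVector k n s′ κH′ a′ κA′
exponentVector-cong refl refl refl refl = refl

exponentVector-deletion : ∀ {k n s κH κ′ a κA} →
  κH ≤ κ′ → κ′ ≤ κH + k → κ′ ≤ κA → k * a + κA ≤ k * s + κ′ →
  Vec.zipWith _+_ (κ′ ∸ κH ∷ 0 ∷ 0 ∷ k ∸ (κ′ ∸ κH) ∷ 0 ∷ []) (exponentVector k n s κ′ a κA)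
    ≡ exponentVector k n (suc s) κH a κA
exponentVector-deletion {s = s} {κH} {κ′} κH≤κ′ κ′≤κH+k κ′≤κA bound = vec-≡
  (trans (ℕ.+-comm (κ′ ∸ κH) _) (∸-telescope κH≤κ′ κ′≤κA)) refl refl
  (deletion-a s κH≤κ′ κ′≤κH+k bound) refl

exponentVector-contraction : ∀ {k n o w s κH a κA} →
  1 ≤ w → w ≤ suc k → o + w ≡ n → suc o ≤ k * a + κA → κA ≤ suc o → let m = suc k ∸ w in
  Vec.zipWith _+_ (0 ∷ m ∷ 0 ∷ 0 ∷ k ∸ m ∷ []) (exponentVector k (suc o) s κH a κA)
    ≡ exponentVector k n (suc s) κH (suc a) κA
exponentVector-contraction {k} {s = s} {κH} {a} {κA} 1≤w w≤1+k o+w≡n o< κA≤ = vec-≡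
  refl (contraction-y a w≤1+k o+w≡n o<) refl (contraction-a k s κH a κA)
  (contraction-b 1≤w w≤1+k o+w≡n κA≤)

exponents : ℕ → (H : Hypergraph) → List (Hyperedge (v H)) → Vec ℕ 5
exponents k H A = exponentVector k (v H) (∣E∣ H) (κ H) (length A) (κ (hypergraph (v H) A))

exponents-↭ : ∀ {H A B} → All NonEmpty A → A ↭ B → exponents k H A ≡ exponents k H B
exponents-↭ {k} {H} {A} {B} nonEmpty A↭B =
  exponentVector-cong {k} {v H} {∣E∣ H} {κH = κ H} refl refl (↭.↭-length A↭B) (κ-↭ {es = A} {B} A↭B nonEmpty)

module _ (H : Hypergraph) (H✓ : All (Sized k) (edges H)) (i : E H) where

  private
    e = edge H i
    es′ = removeAt (edges H) i
    e✓ = All.lookup H✓ (∈-lookup {xs = edges H} i)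
    es′✓ = All-removeAt H✓ i

    -- The component lemmas concern a hyperedge at the head of the list, so `e` is moved there.
    κ-front : κ H ≡ κ (hypergraph (v H) (e ∷ es′))
    κ-front = κ-↭ (↭-removeAt (edges H) i) (All.map sized⇒nonEmpty H✓)

    ∣E∣-front : ∣E∣ H ≡ suc (length es′)
    ∣E∣-front = List.length-removeAt′ (edges H) i

    nonEmpty : ∀ {A} → A ⊑ es′ → All NonEmpty (e ∷ A)
    nonEmpty A⊑es′ = All.map sized⇒nonEmpty (e✓ ∷ All-resp-⊆ A⊑es′ es′✓)

  exponents-deletion : ∀ {A} → A ⊑ es′ →
    Vec.zipWith _+_ (Δ H i ∷ 0 ∷ 0 ∷ k ∸ Δ H i ∷ 0 ∷ []) (exponents k (H ∖ i) A) ≡ exponents k H A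
  exponents-deletion {A} A⊑es′ = trans
    (exponentVector-deletion {k} {v H} {length es′} {κ H} {κ (H ∖ i)} {length A} {κ (hypergraph (v H) A)}
      (subst (_≤ κ (H ∖ i)) (sym κ-front) (κ-anti (xs⊆x∷xs es′ e) (nonEmpty ⊆-refl)))
      (subst (λ c → κ (H ∖ i) ≤ c + k) (sym κ-front) (κ-delete-sized e✓))
      (κ-⊑ es′✓ A⊑es′) (κ-⊑-bound es′✓ A⊑es′))
    (cong (λ s → exponentVector k (v H) s (κ H) (length A) (κ (hypergraph (v H) A))) (sym ∣E∣-front))

  exponents-contraction : ∀ {A} → A ⊑ es′ → let m = suc k ∸ vₑ e in
    Vec.zipWith _+_ (0 ∷ m ∷ 0 ∷ 0 ∷ k ∸ m ∷ []) (exponents k (H / i) (map (contractEdge e) A))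
      ≡ exponents k H (e ∷ A)
  exponents-contraction {A} A⊑es′ = trans
    (exponentVector-contraction {k} {v H} {outside e} {vₑ e} {∣E∣ (H / i)} {κ (H / i)} {length A′} {κ (hypergraph _ A′)}
      (vₑ>0 e (sized⇒nonEmpty e✓)) (vₑ≤1+k e✓) (outside+vₑ e) (v≤κ A′✓) (κ≤v A′✓))
    (exponentVector-cong {k} {v H}
      (trans (cong suc (List.length-map (contractEdge e) es′)) (sym ∣E∣-front))
      (trans (sym (κ-contract (nonEmpty ⊆-refl))) (sym κ-front))
      (cong suc (List.length-map (contractEdge e) A))
      (sym (κ-contract (nonEmpty A⊑es′))))
    where
    A′ = map (contractEdge e) A
    A′✓ : All (Sized k) A′
    A′✓ = All.map⁺ (All.map (λ {f} (sized d≡) → sized (trans (dₑ-contractEdge e f) d≡)) (All-resp-⊆ A⊑es′ es′✓))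

-- The polynomial

private
  module P = FormalSum _+_ 0 ℕ._≟_ 5
  module PM = Multiplication _+_ 0 ℕ._≟_ 5
  module L = FormalSum ℤ._+_ 0ℤ ℤ._≟_ 5
  module LM = Multiplication ℤ._+_ 0ℤ ℤ._≟_ 5

polynomial : ℕ → Hypergraph → Poly.Carrier
polynomial k H = map (λ A → 1ℤ , exponents k H A) (sublists (edges H))

a^*x^ : ∀ i j → (Poly.a Poly.^ i) Poly.* (Poly.x Poly.^ j) ≡ Poly.monomial (j ∷ 0 ∷ 0 ∷ i ∷ 0 ∷ [])
a^*x^ i j = trans
  (cong₂ Poly._*_ (P.monomial-^ (λ n → 0 ∷ 0 ∷ 0 ∷ n ∷ 0 ∷ []) refl (λ _ → refl) i)
                  (P.monomial-^ (λ n → n ∷ 0 ∷ 0 ∷ 0 ∷ 0 ∷ []) refl (λ _ → refl) j))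
  (cong (λ l → Poly.monomial (j ∷ 0 ∷ 0 ∷ l ∷ 0 ∷ [])) (ℕ.+-identityʳ i))

b^*y^ : ∀ i j → (Poly.b Poly.^ i) Poly.* (Poly.y Poly.^ j) ≡ Poly.monomial (0 ∷ j ∷ 0 ∷ 0 ∷ i ∷ [])
b^*y^ i j = trans
  (cong₂ Poly._*_ (P.monomial-^ (λ n → 0 ∷ 0 ∷ 0 ∷ 0 ∷ n ∷ []) refl (λ _ → refl) i)
                  (P.monomial-^ (λ n → 0 ∷ n ∷ 0 ∷ 0 ∷ 0 ∷ []) refl (λ _ → refl) j))
  (cong (λ l → Poly.monomial (0 ∷ j ∷ 0 ∷ 0 ∷ l ∷ [])) (ℕ.+-identityʳ i))

α^ : ∀ i → Poly.α Poly.^ i ≡ Poly.monomial (0 ∷ 0 ∷ i ∷ 0 ∷ 0 ∷ [])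
α^ = P.monomial-^ (λ n → 0 ∷ 0 ∷ n ∷ 0 ∷ 0 ∷ []) refl (λ _ → refl)

polynomial-edgeless : ∀ k H → edges H ≡ [] → polynomial k H ≡ Poly.α Poly.^ v H
polynomial-edgeless k (hypergraph n []) refl = trans
  (cong (λ m → (1ℤ , m) ∷ []) (vec-≡
    (ℕ.n∸n≡0 (κ (hypergraph n [])))
    (trans (cong₂ (λ l c → (l + c) ∸ n) (ℕ.*-zeroʳ k) (κ-edgeless n)) (ℕ.n∸n≡0 n))
    (κ-edgeless n)
    (ℕ.n∸n≡0 (k * 0 + κ (hypergraph n [])))
    (trans (cong (n ∸_) (κ-edgeless n)) (ℕ.n∸n≡0 n))))
  (sym (α^ n))

polynomial-step : ∀ {k} H → All (Sized k) (edges H) → (i : E H) →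
  let m = suc k ∸ vₑ (edge H i) in
  polynomial k H Poly.≈
    (((Poly.a Poly.^ (k ∸ Δ H i)) Poly.* (Poly.x Poly.^ Δ H i)) Poly.* polynomial k (H ∖ i)) Poly.+
    (((Poly.b Poly.^ (k ∸ m)) Poly.* (Poly.y Poly.^ m)) Poly.* polynomial k (H / i))
polynomial-step {k} H H✓ i = subst (polynomial k H Poly.≈_) (cong₂ _++_ deletion contraction) (P.↭⇒≈ split)
  where
  open ≡-Reasoning
  e = edge H i
  es′ = removeAt (edges H) i
  m = suc k ∸ vₑ e
  term : List (Hyperedge (v H)) → ℤ × Vec ℕ 5
  term A = 1ℤ , exponents k H A

  split : polynomial k H ↭ map term (sublists es′) ++ map (term ∘ (e ∷_)) (sublists es′)
  split = sublists-removeAt term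
    (λ A✓ A↭B → cong (1ℤ ,_) (exponents-↭ {k} {H} (All.map sized⇒nonEmpty A✓) A↭B)) (edges H) i H✓

  deletion : map term (sublists es′) ≡
             ((Poly.a Poly.^ (k ∸ Δ H i)) Poly.* (Poly.x Poly.^ Δ H i)) Poly.* polynomial k (H ∖ i)
  deletion = sym (begin
    ((Poly.a Poly.^ (k ∸ Δ H i)) Poly.* (Poly.x Poly.^ Δ H i)) Poly.* polynomial k (H ∖ i)
      ≡⟨ cong (Poly._* polynomial k (H ∖ i)) (a^*x^ (k ∸ Δ H i) (Δ H i)) ⟩
    Poly.monomial w Poly.* polynomial k (H ∖ i)
      ≡⟨ P.monomial-* w (polynomial k (H ∖ i)) ⟩
    P.shift w (polynomial k (H ∖ i))
      ≡⟨ List.map-∘ (sublists es′) ⟨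
    map (λ A → 1ℤ , Vec.zipWith _+_ w (exponents k (H ∖ i) A)) (sublists es′)
      ≡⟨ List.map-cong-local (All.map (λ {A} A⊑ → cong (1ℤ ,_) (exponents-deletion H H✓ i A⊑)) (sublists-⊑ es′)) ⟩
    map term (sublists es′) ∎)
    where w = Δ H i ∷ 0 ∷ 0 ∷ k ∸ Δ H i ∷ 0 ∷ []

  contraction : map (term ∘ (e ∷_)) (sublists es′) ≡
                ((Poly.b Poly.^ (k ∸ m)) Poly.* (Poly.y Poly.^ m)) Poly.* polynomial k (H / i)
  contraction = sym (begin
    ((Poly.b Poly.^ (k ∸ m)) Poly.* (Poly.y Poly.^ m)) Poly.* polynomial k (H / i)
      ≡⟨ cong (Poly._* polynomial k (H / i)) (b^*y^ (k ∸ m) m) ⟩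
    Poly.monomial w Poly.* polynomial k (H / i)
      ≡⟨ P.monomial-* w (polynomial k (H / i)) ⟩
    P.shift w (polynomial k (H / i))
      ≡⟨ List.map-∘ (sublists (edges (H / i))) ⟨
    map (λ A → 1ℤ , Vec.zipWith _+_ w (exponents k (H / i) A)) (sublists (edges (H / i)))
      ≡⟨ cong (map _) (sublists-map (contractEdge e) es′) ⟩
    map (λ A → 1ℤ , Vec.zipWith _+_ w (exponents k (H / i) A)) (map (map (contractEdge e)) (sublists es′))
      ≡⟨ List.map-∘ (sublists es′) ⟨
    map (λ A → 1ℤ , Vec.zipWith _+_ w (exponents k (H / i) (map (contractEdge e) A))) (sublists es′)
      ≡⟨ List.map-cong-local (All.map (λ {A} A⊑ → cong (1ℤ ,_) (exponents-contraction H H✓ i A⊑)) (sublists-⊑ es′)) ⟩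
    map (term ∘ (e ∷_)) (sublists es′) ∎)
    where w = 0 ∷ m ∷ 0 ∷ 0 ∷ k ∸ m ∷ []

-- Uniqueness

recursion-unique : ∀ {ℓ k} {𝓗 : Pred Hypergraph ℓ} {closed : MinorClosed 𝓗} {U U′ : Invariant 𝓗} →
                   Recursion k closed U → Recursion k closed U′ → U ≗ U′
recursion-unique {k = k} {𝓗} {closed} {U} {U′} rec rec′ H H∈𝓗 = go _ H H∈𝓗 refl
  where
  open MinorClosed closed
  open Recursion
  go : ∀ l H (H∈𝓗 : H ∈ 𝓗) → ∣E∣ H ≡ l → U H H∈𝓗 Poly.≈ U′ H H∈𝓗
  go zero    (hypergraph n []) H∈𝓗 _ m =
    trans (edgeless rec _ H∈𝓗 refl m) (sym (edgeless rec′ _ H∈𝓗 refl m))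
  -- The recursion at a single hyperedge already determines the value, so the first one is used.
  go (suc l) H@(hypergraph n (e ∷ es)) H∈𝓗 ∣E∣≡ m = trans (step rec H H∈𝓗 zero m) (trans
    (P.+-cong {c₁ P.* U (H ∖ zero) _} {c₁ P.* U′ (H ∖ zero) _} {c₂ P.* U (H / zero) _} {c₂ P.* U′ (H / zero) _}
      (PM.*-cong {c₁} {c₁} {U (H ∖ zero) _} {U′ (H ∖ zero) _} (λ _ → refl)
        (go l (H ∖ zero) (deletion H∈𝓗 zero) (ℕ.suc-injective ∣E∣≡)))
      (PM.*-cong {c₂} {c₂} {U (H / zero) _} {U′ (H / zero) _} (λ _ → refl)
        (go l (H / zero) (contraction H∈𝓗 zero) (trans (List.length-map (contractEdge e) es) (ℕ.suc-injective ∣E∣≡))))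
      m)
    (sym (step rec′ H H∈𝓗 zero m)))
    where
    c₁ c₂ : Poly.Carrier
    c₁ = (Poly.a Poly.^ (k ∸ Δ H zero)) Poly.* (Poly.x Poly.^ Δ H zero)
    c₂ = (Poly.b Poly.^ (k ∸ (suc k ∸ vₑ e))) Poly.* (Poly.y Poly.^ (suc k ∸ vₑ e))

-- The exponents of (αx/b)^i (y/a)^j.
termVector : ℕ → ℕ → Vec ℤ 5
termVector i j = ℤ.+ i ∷ ℤ.+ j ∷ ℤ.+ i ∷ ℤ.- ℤ.+ j ∷ ℤ.- ℤ.+ i ∷ []

-1-n : ∀ n → ℤ.- ℤ.+ suc n ≡ -1ℤ ℤ.+ (ℤ.- ℤ.+ n)
-1-n zero    = refl
-1-n (suc n) = refl

-- Subtracting 1 leaves `αx/b` and `y/a` only up to `≈`, so congruence of powers and products is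
-- required here.
substituted-term : ∀ i j →
  (((Laurent.α Laurent.* Laurent.x Laurent.* Laurent.b⁻¹ Laurent.+ Laurent.1#) Laurent.+ Laurent.- Laurent.1#) Laurent.^ i)
  Laurent.*
  (((Laurent.y Laurent.* Laurent.a⁻¹ Laurent.+ Laurent.1#) Laurent.+ Laurent.- Laurent.1#) Laurent.^ j)
  Laurent.≈ Laurent.monomial (termVector i j)
substituted-term i j = L.≈-trans {(X₁ L.^ i) L.* (Y₁ L.^ j)} {(X L.^ i) L.* (Y L.^ j)} {L.monomial (termVector i j)}
  (LM.*-cong {X₁ L.^ i} {X L.^ i} {Y₁ L.^ j} {Y L.^ j}
    (LM.^-cong {X₁} {X} i (L.monomial+1-1 ξ)) (LM.^-cong {Y₁} {Y} j (L.monomial+1-1 η)))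
  (L.≈-reflexive (trans
    (cong₂ L._*_
      (L.monomial-^ (λ n → ℤ.+ n ∷ 0ℤ ∷ ℤ.+ n ∷ 0ℤ ∷ ℤ.- ℤ.+ n ∷ []) refl (λ n → vec-≡ refl refl refl refl (-1-n n)) i)
      (L.monomial-^ (λ n → 0ℤ ∷ ℤ.+ n ∷ 0ℤ ∷ ℤ.- ℤ.+ n ∷ 0ℤ ∷ []) refl (λ n → vec-≡ refl refl refl (-1-n n) refl) j))
    (cong L.monomial (vec-≡ (ℤ.+-identityʳ _) refl (ℤ.+-identityʳ _) (ℤ.+-identityˡ _) (ℤ.+-identityʳ _)))))
  where
  ξ η : L.Exponent
  ξ = 1ℤ ∷ 0ℤ ∷ 1ℤ ∷ 0ℤ ∷ -1ℤ ∷ []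
  η = 0ℤ ∷ 1ℤ ∷ 0ℤ ∷ -1ℤ ∷ 0ℤ ∷ []
  X Y X₁ Y₁ : L.Carrier
  X = L.monomial ξ
  Y = L.monomial η
  X₁ = (X L.+ L.1#) L.+ L.- L.1#
  Y₁ = (Y L.+ L.1#) L.+ L.- L.1#

prefactor : ∀ i p q → (Laurent.α Laurent.^ i) Laurent.* (Laurent.a Laurent.^ p) Laurent.* (Laurent.b Laurent.^ q)
            ≡ Laurent.monomial (0ℤ ∷ 0ℤ ∷ ℤ.+ i ∷ ℤ.+ p ∷ ℤ.+ q ∷ [])
prefactor i p q = trans
  (cong₂ L._*_ (cong₂ L._*_
    (L.monomial-^ (λ n → 0ℤ ∷ 0ℤ ∷ ℤ.+ n ∷ 0ℤ ∷ 0ℤ ∷ []) refl (λ _ → refl) i)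
    (L.monomial-^ (λ n → 0ℤ ∷ 0ℤ ∷ 0ℤ ∷ ℤ.+ n ∷ 0ℤ ∷ []) refl (λ _ → refl) p))
    (L.monomial-^ (λ n → 0ℤ ∷ 0ℤ ∷ 0ℤ ∷ 0ℤ ∷ ℤ.+ n ∷ []) refl (λ _ → refl) q))
  (cong L.monomial (vec-≡ refl refl
    (cong (ℤ.+_) (trans (ℕ.+-identityʳ (i + 0)) (ℕ.+-identityʳ i))) (cong (ℤ.+_) (ℕ.+-identityʳ p)) refl))

pos-minus : ∀ {p r j} → r + j ≡ p → ℤ.+ p ℤ.+ (ℤ.- ℤ.+ j) ≡ ℤ.+ r
pos-minus {r = r} {j} refl = trans (ℤ.m-n≡m⊖n (r + j) j)
  (trans (ℤ.⊖-≥ (ℕ.m≤n+m j r)) (cong (ℤ.+_) (ℕ.m+n∸n≡m r j)))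

-- The prefactor absorbs the negative exponents of `a` and `b`: each entry is a telescoping
-- difference along the chain formed by the four hypotheses.
exponentVector-closed : ∀ {k n s κH a κA} → κH ≤ κA → κA ≤ n → n ≤ k * a + κA → k * a + κA ≤ k * s + κH →
  Vec.zipWith ℤ._+_ (0ℤ ∷ 0ℤ ∷ ℤ.+ κH ∷ ℤ.+ ((k * s + κH) ∸ n) ∷ ℤ.+ (n ∸ κH) ∷ [])
                    (termVector (κA ∸ κH) ((k * a + κA) ∸ n))
    ≡ Vec.map (ℤ.+_) (exponentVector k n s κH a κA)
exponentVector-closed κH≤κA κA≤n n≤ bound = vec-≡ refl refl
  (cong (ℤ.+_) (ℕ.m+[n∸m]≡n κH≤κA)) (pos-minus (∸-telescope n≤ bound)) (pos-minus (∸-telescope κH≤κA κA≤n))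

+-foldr-≈ : ∀ {A : Set} {f : A → L.Carrier} {g : A → L.Exponent} {xs} →
  All (λ x → f x L.≈ L.monomial (g x)) xs → foldr L._+_ L.0# (map f xs) L.≈ map (λ x → 1ℤ , g x) xs
+-foldr-≈ [] = λ _ → refl
+-foldr-≈ {f = f} {g} {x ∷ xs} (fx≈ ∷ fxs≈) =
  L.+-cong {f x} {L.monomial (g x)} {foldr L._+_ L.0# (map f xs)}
    {map (λ x → 1ℤ , g x) xs} fx≈ (+-foldr-≈ {f = f} {g} fxs≈)

polynomial-closed : ∀ {k} H → All (Sized k) (edges H) → Laurent.ι (polynomial k H) Laurent.≈ closedForm k H
polynomial-closed {k} H H✓ = L.≈-sym {closedForm k H} {Laurent.ι (polynomial k H)}
  (L.≈-trans {closedForm k H} {L.monomial w L.* S} {Laurent.ι (polynomial k H)}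
    (LM.*-cong {prefix} {L.monomial w} {T} {S}
      (L.≈-reflexive (prefactor (κ H) p q)) (+-foldr-≈ {g = g} (All.map term-≈ (sublists-⊑ (edges H)))))
    (L.≈-reflexive (begin
      L.monomial w L.* S
        ≡⟨ L.monomial-* w S ⟩
      L.shift w S
        ≡⟨ List.map-∘ (sublists (edges H)) ⟨
      map (λ A → 1ℤ , Vec.zipWith ℤ._+_ w (g A)) (sublists (edges H))
        ≡⟨ List.map-cong-local (All.map shifted (sublists-⊑ (edges H))) ⟩
      map (λ A → 1ℤ , Vec.map (ℤ.+_) (exponents k H A)) (sublists (edges H))
        ≡⟨ List.map-∘ (sublists (edges H)) ⟩
      Laurent.ι (polynomial k H) ∎)))
  where
  open ≡-Reasoning
  p = (k * ∣E∣ H + κ H) ∸ v H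
  q = v H ∸ κ H
  w = 0ℤ ∷ 0ℤ ∷ ℤ.+ κ H ∷ ℤ.+ p ∷ ℤ.+ q ∷ []
  K : List (Hyperedge (v H)) → ℕ
  K A = κ (hypergraph (v H) A)
  g : List (Hyperedge (v H)) → L.Exponent
  g A = termVector (K A ∸ κ H) ((k * length A + K A) ∸ v H)
  S prefix T : L.Carrier
  S = map (λ A → 1ℤ , g A) (sublists (edges H))
  prefix = (Laurent.α Laurent.^ κ H) Laurent.* (Laurent.a Laurent.^ p) Laurent.* (Laurent.b Laurent.^ q)
  X Y : L.Carrier
  X = Laurent.α Laurent.* Laurent.x Laurent.* Laurent.b⁻¹ Laurent.+ Laurent.1#
  Y = Laurent.y Laurent.* Laurent.a⁻¹ Laurent.+ Laurent.1#
  T = T-HG Laurent.rawRing H X Y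

  -- Uniformity gives d(A) = (k+1)|A|, and one |A| cancels.
  rank : ∀ {A} → A ⊑ edges H → (sum (map dₑ A) + K A) ∸ (length A + v H) ≡ (k * length A + K A) ∸ v H
  rank {A} A⊑ = begin
    (sum (map dₑ A) + K A) ∸ (length A + v H)
      ≡⟨ cong (λ d → (d + K A) ∸ (length A + v H)) (sum-sized (All-resp-⊆ A⊑ H✓)) ⟩
    (length A + k * length A + K A) ∸ (length A + v H)
      ≡⟨ cong (_∸ (length A + v H)) (ℕ.+-assoc (length A) _ (K A)) ⟩
    (length A + (k * length A + K A)) ∸ (length A + v H)
      ≡⟨ ℕ.[m+n]∸[m+o]≡n∸o (length A) _ (v H) ⟩
    (k * length A + K A) ∸ v H ∎

  term-≈ : ∀ {A} → A ⊑ edges H →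
    ((X L.+ L.- L.1#) L.^ (K A ∸ κ H)) L.* ((Y L.+ L.- L.1#) L.^ ((sum (map dₑ A) + K A) ∸ (length A + v H)))
      L.≈ L.monomial (g A)
  term-≈ {A} A⊑ = subst
    (λ j → ((X L.+ L.- L.1#) L.^ (K A ∸ κ H)) L.* ((Y L.+ L.- L.1#) L.^ j) L.≈ L.monomial (g A))
    (sym (rank A⊑)) (substituted-term (K A ∸ κ H) ((k * length A + K A) ∸ v H))

  shifted : ∀ {A} → A ⊑ edges H →
    (1ℤ , Vec.zipWith ℤ._+_ w (g A)) ≡ (1ℤ , Vec.map (ℤ.+_) (exponents k H A))
  shifted A⊑ = cong (1ℤ ,_) (exponentVector-closed {k}
    (κ-⊑ H✓ A⊑) (κ≤v (All-resp-⊆ A⊑ H✓)) (v≤κ (All-resp-⊆ A⊑ H✓)) (κ-⊑-bound H✓ A⊑))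

theorem4p5 : ∀ {ℓ} (k : ℕ) → 1 ≤ k →
    (𝓗 : Pred Hypergraph ℓ) → 𝓗 ⊆ Uniform (suc k) → (closed : MinorClosed 𝓗) →
    ∃! _≗_ (Recursion k closed) ×
    (∀ (U : Invariant 𝓗) → Recursion k closed U →
    ∀ (H : Hypergraph) (H∈𝓗 : H ∈ 𝓗) →
    Laurent.ι (U H H∈𝓗) Laurent.≈ closedForm k H)
theorem4p5 k _ 𝓗 uniform closed =
  (U₀ , rec₀ , λ {U} rec → recursion-unique {closed = closed} {U₀} {U} rec₀ rec) , λ U rec H H∈𝓗 →
    L.≈-trans {Laurent.ι (U H H∈𝓗)} {Laurent.ι (U₀ H H∈𝓗)} {closedForm k H}
      -- `ι` respects `≈`, so the formula for `U₀` passes to every solution `U`.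
      (map₂-cong {_⊕₁_ = _+_} {0} {ℕ._≟_} {5} {_⊕₂_ = ℤ._+_} {0ℤ} {ℤ._≟_} {5} (Vec.map (ℤ.+_))
        {U H H∈𝓗} {U₀ H H∈𝓗} (recursion-unique {closed = closed} {U} {U₀} rec rec₀ H H∈𝓗))
      (polynomial-closed H (uniform⇒sized (uniform H∈𝓗)))
  where
  U₀ : Invariant 𝓗
  U₀ H _ = polynomial k H
  rec₀ : Recursion k closed U₀
  rec₀ = record
    { edgeless = λ H _ es≡[] → P.≈-reflexive (polynomial-edgeless k H es≡[])
    ; step     = λ H H∈𝓗 i → polynomial-step H (uniform⇒sized (uniform H∈𝓗)) i }
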